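{- Let $G^\sigma$ be a signed graph whose underlying graph $G$ is connected and bipartite, and whose adjacency matrix has all but at most two eigenvalues (counted with multiplicity) equal to $\pm1$. Then $G^\sigma$ is switching isomorphic with an unsigned (all edges positive) connected bipartite graph whose adjacency matrix also has all but at most two eigenvalues equal to $\pm 1$.
   Context: A signed graph $G^\sigma$ is a finite simple graph $G$ with a signature $\sigma:E(G)\to\{ -1,+1\}$; its adjacency matrix has entry $\sigma(\{u,v\})$ for edges and $0$ otherwise. Switching with respect to a vertex subset $X$ changes the sign of every edge between $X$ and $V\setminus X$; two signed graphs are switching isomorphic if one can be switched into an isomorphic copy of the other. -}

module Defs where

open import Data.Nat as ℕ using (ℕ; zero; suc; _≤_)
open import Data.Integer as ℤ using (ℤ; +_; -_; _+_; _*_; _-_; _^_)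
open import Data.Fin using (Fin; zero; suc; punchIn; toℕ; _≟_)
open import Data.Fin.Permutation using (Permutation′; _⟨$⟩ʳ_)
open import Data.Bool using (Bool; true; false; if_then_else_; _xor_)
open import Data.Sign using (Sign) renaming (_*_ to _*ˢ_)
open import Data.Product using (Σ; _×_; ∃)
open import Relation.Binary.PropositionalEquality using (_≡_; _≢_)
open import Relation.Nullary using (does)

record Graph (n : ℕ) : Set where
  field
    adj   : Fin n → Fin n → Bool
    sym   : ∀ i j → adj i j ≡ adj j i
    irr   : ∀ i → adj i i ≡ false
open Graph public

-- Signed graph: underlying graph plus a (symmetric) signature; its values on
-- non-edges are irrelevant.
record SignedGraph (n : ℕ) : Set where
  field
    graph : Graph n
    sig   : Fin n → Fin n → Sign
    sigSym : ∀ i j → sig i j ≡ sig j i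
open SignedGraph public

signToℤ : Sign → ℤ
signToℤ Sign.+ = + 1
signToℤ Sign.- = - (+ 1)

Matrix : ℕ → Set
Matrix n = Fin n → Fin n → ℤ

adjMatrix : ∀ {n} → Graph n → Matrix n
adjMatrix G i j = if adj G i j then + 1 else + 0

signedAdjMatrix : ∀ {n} → SignedGraph n → Matrix n
signedAdjMatrix S i j = if adj (graph S) i j then signToℤ (sig S i j) else + 0

data Walk {n : ℕ} (G : Graph n) : Fin n → Fin n → Set where
  here : ∀ {i} → Walk G i i
  step : ∀ {i j k} → adj G i j ≡ true → Walk G j k → Walk G i k

Connected : ∀ {n} → Graph n → Set
Connected G = ∀ i j → Walk G i j

Bipartite : ∀ {n} → Graph n → Set
Bipartite {n} G = Σ (Fin n → Bool) λ c → ∀ i j → adj G i j ≡ true → c i ≢ c j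

switch : ∀ {n} → SignedGraph n → (Fin n → Bool) → SignedGraph n
switch S X = record
  { graph = graph S
  ; sig = λ i j → sig S i j *ˢ (if X i xor X j then Sign.- else Sign.+)
  ; sigSym = sigSym′ }
  where
  open import Relation.Binary.PropositionalEquality using (cong₂)
  open import Data.Bool.Properties using (xor-comm)
  sigSym′ : ∀ i j → _
  sigSym′ i j = cong₂ (λ a b → a *ˢ (if b then Sign.- else Sign.+)) (sigSym S i j) (xor-comm (X i) (X j))

SwitchingIsoToUnsigned : ∀ {n} → SignedGraph n → Graph n → Set
SwitchingIsoToUnsigned {n} S H =
  Σ (Fin n → Bool) λ X → Σ (Permutation′ n) λ π →
    ∀ i j → signedAdjMatrix (switch S X) i j ≡ adjMatrix H (π ⟨$⟩ʳ i) (π ⟨$⟩ʳ j)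

sumFin : ∀ {n} → (Fin n → ℤ) → ℤ
sumFin {zero} f = + 0
sumFin {suc n} f = f zero + sumFin (λ i → f (suc i))

altSign : ℕ → ℤ
altSign zero = + 1
altSign (suc zero) = - (+ 1)
altSign (suc (suc k)) = altSign k

det : ∀ {n} → Matrix n → ℤ
det {zero} M = + 1
det {suc n} M = sumFin λ j →
  altSign (toℕ j) * M zero j * det (λ r c → M (suc r) (punchIn j c))

charPolyAt : ∀ {n} → Matrix n → ℤ → ℤ
charPolyAt A t = det λ i j → (if does (i ≟ j) then t else + 0) - A i j

-- "All but at most two eigenvalues (with multiplicity) of A equal ±1":
-- the characteristic polynomial is (x−1)^a (x+1)^b q(x) with q of degree ≤ 2 and
-- a + b ≥ n − 2, i.e. 1 and −1 together have algebraic multiplicity ≥ n − 2.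
-- (Integer polynomials are equal iff they agree at all integers; a monic integer
-- polynomial divided by a monic integer polynomial has an integer quotient.)
AllButTwoEigenvaluesPM1 : ∀ {n} → Matrix n → Set
AllButTwoEigenvaluesPM1 {n} A =
  Σ ℕ λ a → Σ ℕ λ b → Σ ℤ λ c₀ → Σ ℤ λ c₁ → Σ ℤ λ c₂ →
    (n ≤ a ℕ.+ b ℕ.+ 2) ×
    (∀ t → charPolyAt A t ≡ (t - + 1) ^ a * (t + + 1) ^ b * (c₀ + c₁ * t + c₂ * t * t))

{-# OPTIONS --safe #-}

-- Put B = A² − I and let p be the characteristic polynomial of A. For a matrix C
-- write D(C)(t) for the derivative of det at tI − A in the direction C, that is
-- tr(C adj(tI − A)). Then D(I) = p′, D(CA) = t D(C) − tr(C) p, and D(C) has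
-- degree below n. If p = (x−1)^a (x+1)^b q and w = (x²−1) q, then w p′ = g p for an
-- explicit g, hence D(w(A)) is a multiple of p; by degree it vanishes, so
-- tr(w(A) Aᵏ) = 0 for all k, tr(w(A)²) = 0, and w(A) = 0 because A is symmetric.
-- Separating even and odd powers of A in the bipartite case gives 2B² = tr(B) B.
-- On the colour class U with the smaller share of tr B this forces B to have rank
-- at most one, so (deg i − 1)(deg j − 1) = ⟨row i, row j⟩² for i ≠ j in U. Were two
-- common neighbours of i and j to contribute opposite signs to ⟨row i, row j⟩, its
-- absolute value would be at most deg − 2 for both degrees, which is impossible.
-- Thus the rows of U agree on common neighbours up to signs, and these signs are
-- consistent by rank one; they define the switching.
module Submission where

open import Defs
open import Data.Bool.Base using (Bool; true; false; if_then_else_; not; _xor_)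
import Data.Bool.Properties as Boolₚ
open import Data.Empty using (⊥)
open import Data.Fin.Base using (Fin; zero; suc; punchIn; toℕ)
open import Data.Fin.Permutation using () renaming (id to idₚ)
open import Data.Fin.Properties using (_≟_; any?)
open import Data.Integer.Base as ℤ using (ℤ; +_; -_; _+_; _*_; _-_; _^_; _≤_; 0ℤ; 1ℤ; -1ℤ; ∣_∣)
import Data.Integer.Properties as ℤₚ
open import Data.Integer.Tactic.RingSolver using (solve-∀)
open import Data.Nat.Base as ℕ using (ℕ; zero; suc; z≤n; s≤s)
import Data.Nat.Properties as ℕₚ
open import Data.Product using (Σ; _×_; _,_; proj₁; proj₂)
open import Data.Sign.Base using (Sign) renaming (_*_ to _*ˢ_)
open import Data.Sum using (_⊎_; inj₁; inj₂)
open import Function using (_∘_)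
open import Relation.Binary.PropositionalEquality using (_≡_; _≢_; refl; trans; cong; cong₂; subst; module ≡-Reasoning) renaming (sym to ≡-sym)
open import Relation.Nullary using (¬_; Dec; yes; no; does; contradiction)
open import Relation.Nullary.Decidable using (_×-dec_; ¬?)

-- Finite sums

-- Over the integers no eigenvectors are at hand, so every spectral fact is recast as an identity
-- between traces. The model is this. Every eigenvalue is a root of w, so w cancels the poles of
-- p′/p, and a symmetric matrix, being diagonalisable, is annihilated by w whatever the
-- multiplicities. The spectrum of a bipartite graph is symmetric about 0; in the main case the
-- exceptional eigenvalues are ±θ with θ² = -c₀/c₂, and B has θ² - 1 twice and 0 elsewhere, which is
-- the origin of the 2 in 2B² = tr(B) B. Each class should receive one of these two eigenvectors.
-- Instead of comparing the two shares of the trace, the proof takes the smaller one, T₁: there a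
-- sum of squares is a nonnegative multiple of 2T₁ - T with T = tr B, and so must vanish.
-- Polynomials are handled only through their values: a growth bound plays the role of the degree,
-- and coefficients are read off from values at all large integers.

sum-cong : ∀ {n} {f g : Fin n → ℤ} → (∀ i → f i ≡ g i) → sumFin f ≡ sumFin g
sum-cong {zero}  eq = refl
sum-cong {suc n} eq = cong₂ _+_ (eq zero) (sum-cong (eq ∘ suc))

sum-zero : ∀ {n} {f : Fin n → ℤ} → (∀ i → f i ≡ 0ℤ) → sumFin f ≡ 0ℤ
sum-zero {zero}  eq = refl
sum-zero {suc n} eq = cong₂ _+_ (eq zero) (sum-zero (eq ∘ suc))

sum-+ : ∀ {n} (f g : Fin n → ℤ) → sumFin (λ i → f i + g i) ≡ sumFin f + sumFin g
sum-+ {zero}  f g = refl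
sum-+ {suc n} f g = trans (cong (_+_ (f zero + g zero)) (sum-+ (f ∘ suc) (g ∘ suc)))
                          (interchange (f zero) (g zero) _ _)
  where
  interchange : ∀ a b c d → a + b + (c + d) ≡ a + c + (b + d)
  interchange = solve-∀

sum-*ˡ : ∀ {n} x (f : Fin n → ℤ) → sumFin (λ i → x * f i) ≡ x * sumFin f
sum-*ˡ {zero}  x f = ≡-sym (ℤₚ.*-zeroʳ x)
sum-*ˡ {suc n} x f = trans (cong (_+_ (x * f zero)) (sum-*ˡ x (f ∘ suc)))
                           (≡-sym (ℤₚ.*-distribˡ-+ x (f zero) _))

sum-*ʳ : ∀ {n} x (f : Fin n → ℤ) → sumFin (λ i → f i * x) ≡ sumFin f * x
sum-*ʳ x f = trans (sum-cong λ i → ℤₚ.*-comm (f i) x)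
                   (trans (sum-*ˡ x f) (ℤₚ.*-comm x (sumFin f)))

sum-linear : ∀ {n} x y (f g : Fin n → ℤ) →
             sumFin (λ i → x * f i + y * g i) ≡ x * sumFin f + y * sumFin g
sum-linear x y f g = trans (sum-+ (λ i → x * f i) (λ i → y * g i))
                           (cong₂ _+_ (sum-*ˡ x f) (sum-*ˡ y g))

sum-swap : ∀ {m n} (f : Fin m → Fin n → ℤ) →
           sumFin (λ i → sumFin (f i)) ≡ sumFin (λ j → sumFin (λ i → f i j))
sum-swap {zero}  {n} f = ≡-sym (sum-zero {n} λ _ → refl)
sum-swap {suc m} f = trans (cong (_+_ (sumFin (f zero))) (sum-swap (f ∘ suc)))
                           (≡-sym (sum-+ (f zero) _))

Id : ∀ {n} → Matrix n
Id i j = if does (i ≟ j) then 1ℤ else 0ℤ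

Id-diag : ∀ {n} (i : Fin n) → Id i i ≡ 1ℤ
Id-diag zero    = refl
Id-diag (suc i) = Id-diag i

Id-off : ∀ {n} {i j : Fin n} → i ≢ j → Id i j ≡ 0ℤ
Id-off {i = zero}  {zero}  i≢j = contradiction refl i≢j
Id-off {i = zero}  {suc j} i≢j = refl
Id-off {i = suc i} {zero}  i≢j = refl
Id-off {i = suc i} {suc j} i≢j = Id-off (i≢j ∘ cong suc)

Id-sym : ∀ {n} (i j : Fin n) → Id i j ≡ Id j i
Id-sym zero    zero    = refl
Id-sym zero    (suc j) = refl
Id-sym (suc i) zero    = refl
Id-sym (suc i) (suc j) = Id-sym i j

sum-Idˡ : ∀ {n} (i : Fin n) (f : Fin n → ℤ) → sumFin (λ k → Id i k * f k) ≡ f i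
sum-Idˡ zero    f = trans (cong₂ _+_ (ℤₚ.*-identityˡ (f zero)) (sum-zero λ k → ℤₚ.*-zeroˡ (f (suc k)))) (ℤₚ.+-identityʳ _)
sum-Idˡ (suc i) f = trans (cong₂ _+_ (ℤₚ.*-zeroˡ (f zero)) (sum-Idˡ i (f ∘ suc))) (ℤₚ.+-identityˡ _)

sum-Idʳ : ∀ {n} (j : Fin n) (f : Fin n → ℤ) → sumFin (λ k → f k * Id k j) ≡ f j
sum-Idʳ j f = trans (sum-cong λ k → trans (ℤₚ.*-comm (f k) (Id k j)) (cong (_* f k) (Id-sym k j)))
                    (sum-Idˡ j f)

-- Determinants

det-cong : ∀ {n} {M N : Matrix n} → (∀ i j → M i j ≡ N i j) → det M ≡ det N
det-cong {zero}  eq = refl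
det-cong {suc n} eq = sum-cong λ j →
  cong₂ _*_ (cong (_*_ (altSign (toℕ j))) (eq zero j)) (det-cong λ r c → eq (suc r) (punchIn j c))

infixl 10 _[_≔_]
_[_≔_] : ∀ {a} {X : Set a} {n} → (Fin n → X) → Fin n → X → Fin n → X
(f [ zero  ≔ x ]) zero    = x
(f [ zero  ≔ x ]) (suc i) = f (suc i)
(f [ suc r ≔ x ]) zero    = f zero
(f [ suc r ≔ x ]) (suc i) = ((f ∘ suc) [ r ≔ x ]) i

≔-at : ∀ {a} {X : Set a} {n} (f : Fin n → X) r x → (f [ r ≔ x ]) r ≡ x
≔-at f zero    x = refl
≔-at f (suc r) x = ≔-at (f ∘ suc) r x

≔-off : ∀ {a} {X : Set a} {n} (f : Fin n → X) {r i} x → r ≢ i → (f [ r ≔ x ]) i ≡ f i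
≔-off f {zero}  {zero}  x r≢i = contradiction refl r≢i
≔-off f {zero}  {suc i} x r≢i = refl
≔-off f {suc r} {zero}  x r≢i = refl
≔-off f {suc r} {suc i} x r≢i = ≔-off (f ∘ suc) x (r≢i ∘ cong suc)

≔-id : ∀ {a} {X : Set a} {n} (f : Fin n → X) r i → (f [ r ≔ f r ]) i ≡ f i
≔-id f zero    zero    = refl
≔-id f zero    (suc i) = refl
≔-id f (suc r) zero    = refl
≔-id f (suc r) (suc i) = ≔-id (f ∘ suc) r i

≔-comm : ∀ {a} {X : Set a} {n} (f : Fin n → X) {r s} x y → r ≢ s → ∀ i →
         (f [ r ≔ x ] [ s ≔ y ]) i ≡ (f [ s ≔ y ] [ r ≔ x ]) i
≔-comm f {zero}  {zero}  x y r≢s i       = contradiction refl r≢s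
≔-comm f {zero}  {suc s} x y r≢s zero    = refl
≔-comm f {zero}  {suc s} x y r≢s (suc i) = refl
≔-comm f {suc r} {zero}  x y r≢s zero    = refl
≔-comm f {suc r} {zero}  x y r≢s (suc i) = refl
≔-comm f {suc r} {suc s} x y r≢s zero    = refl
≔-comm f {suc r} {suc s} x y r≢s (suc i) = ≔-comm (f ∘ suc) x y (r≢s ∘ cong suc) i

≔-map : ∀ {a b} {X : Set a} {Y : Set b} {n} (h : X → Y) (f : Fin n → X) r x i →
        h ((f [ r ≔ x ]) i) ≡ ((h ∘ f) [ r ≔ h x ]) i
≔-map h f zero    x zero    = refl
≔-map h f zero    x (suc i) = refl
≔-map h f (suc r) x zero    = refl
≔-map h f (suc r) x (suc i) = ≔-map h (f ∘ suc) r x i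

≔-cong : ∀ {n} {M N : Matrix n} r {u v : Fin n → ℤ} → (∀ i j → M i j ≡ N i j) → (∀ j → u j ≡ v j) →
         ∀ i j → (M [ r ≔ u ]) i j ≡ (N [ r ≔ v ]) i j
≔-cong {M = M} {N} r {u} {v} M≗N u≗v i j with r ≟ i
... | yes refl = trans (cong (λ f → f j) (≔-at M r u)) (trans (u≗v j) (cong (λ f → f j) (≡-sym (≔-at N r v))))
... | no  r≢i  = trans (cong (λ f → f j) (≔-off M u r≢i)) (trans (M≗N i j) (cong (λ f → f j) (≡-sym (≔-off N v r≢i))))

minor : ∀ {n} → Matrix (suc n) → Fin (suc n) → Matrix n
minor M j r c = M (suc r) (punchIn j c)

det-minor-≔ : ∀ {n} (M : Matrix (suc n)) r v j →
              det (minor (M [ suc r ≔ v ]) j) ≡ det (minor M j [ r ≔ v ∘ punchIn j ])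
det-minor-≔ M r v j = det-cong λ i c → cong (λ f → f c) (≔-map (_∘ punchIn j) (M ∘ suc) r v i)

det-linear : ∀ {n} (M : Matrix n) r x y (u v : Fin n → ℤ) →
             det (M [ r ≔ (λ c → x * u c + y * v c) ]) ≡ x * det (M [ r ≔ u ]) + y * det (M [ r ≔ v ])
det-linear {suc n} M zero x y u v =
  trans (sum-cong λ j → distrib (altSign (toℕ j)) x (u j) y (v j) (det (minor M j)))
        (sum-linear x y (λ j → altSign (toℕ j) * u j * det (minor M j))
                        (λ j → altSign (toℕ j) * v j * det (minor M j)))
  where
  distrib : ∀ s x u y v d → s * (x * u + y * v) * d ≡ x * (s * u * d) + y * (s * v * d)
  distrib = solve-∀
det-linear {suc n} M (suc r) x y u v =
  trans (sum-cong step′) (sum-linear x y (term u) (term v))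
  where
  term : (Fin (suc n) → ℤ) → Fin (suc n) → ℤ
  term v j = altSign (toℕ j) * M zero j * det (minor (M [ suc r ≔ v ]) j)
  distrib : ∀ s x u y v → s * (x * u + y * v) ≡ x * (s * u) + y * (s * v)
  distrib = solve-∀
  step′ : ∀ j → term (λ c → x * u c + y * v c) j ≡ x * term u j + y * term v j
  step′ j = begin
    s * det (minor (M [ suc r ≔ (λ c → x * u c + y * v c) ]) j)
      ≡⟨ cong (s *_) (det-minor-≔ M r _ j) ⟩
    s * det (minor M j [ r ≔ (λ c → x * u (punchIn j c) + y * v (punchIn j c)) ])
      ≡⟨ cong (s *_) (det-linear (minor M j) r x y (u ∘ punchIn j) (v ∘ punchIn j)) ⟩
    s * (x * det (minor M j [ r ≔ u ∘ punchIn j ]) + y * det (minor M j [ r ≔ v ∘ punchIn j ]))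
      ≡⟨ cong (s *_) (cong₂ (λ a b → x * a + y * b) (det-minor-≔ M r u j) (det-minor-≔ M r v j)) ⟨
    s * (x * det (minor (M [ suc r ≔ u ]) j) + y * det (minor (M [ suc r ≔ v ]) j))
      ≡⟨ distrib s x _ y _ ⟩
    x * term u j + y * term v j ∎
    where
    open ≡-Reasoning
    s = altSign (toℕ j) * M zero j

det-zero-row : ∀ {n} (M : Matrix n) r {v : Fin n → ℤ} → (∀ c → v c ≡ 0ℤ) → det (M [ r ≔ v ]) ≡ 0ℤ
det-zero-row M r {v} v≡0 = begin
  det (M [ r ≔ v ])                             ≡⟨ det-cong (≔-cong r (λ _ _ → refl) (λ c → trans (v≡0 c) (≡-sym (vanish (v c))))) ⟩
  det (M [ r ≔ (λ c → 0ℤ * v c + 0ℤ * v c) ])   ≡⟨ det-linear M r 0ℤ 0ℤ v v ⟩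
  0ℤ * det (M [ r ≔ v ]) + 0ℤ * det (M [ r ≔ v ]) ≡⟨ vanish (det (M [ r ≔ v ])) ⟩
  0ℤ ∎
  where
  open ≡-Reasoning
  vanish : ∀ x → 0ℤ * x + 0ℤ * x ≡ 0ℤ
  vanish = solve-∀

det-linear-sum : ∀ {m n} (M : Matrix n) r (x : Fin m → ℤ) (V : Fin m → Fin n → ℤ) →
                 det (M [ r ≔ (λ c → sumFin (λ k → x k * V k c)) ]) ≡ sumFin (λ k → x k * det (M [ r ≔ V k ]))
det-linear-sum {zero}  M r x V = det-zero-row M r λ _ → refl
det-linear-sum {suc m} M r x V = begin
  det (M [ r ≔ (λ c → x zero * V zero c + rest c) ])
    ≡⟨ det-cong (≔-cong r (λ _ _ → refl) λ c → cong (_+_ (x zero * V zero c)) (≡-sym (ℤₚ.*-identityˡ (rest c)))) ⟩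
  det (M [ r ≔ (λ c → x zero * V zero c + 1ℤ * rest c) ])
    ≡⟨ det-linear M r (x zero) 1ℤ (V zero) rest ⟩
  x zero * det (M [ r ≔ V zero ]) + 1ℤ * det (M [ r ≔ rest ])
    ≡⟨ cong (_+_ (x zero * det (M [ r ≔ V zero ]))) (trans (ℤₚ.*-identityˡ _) (det-linear-sum M r (x ∘ suc) (V ∘ suc))) ⟩
  x zero * det (M [ r ≔ V zero ]) + sumFin (λ k → x (suc k) * det (M [ r ≔ V (suc k) ])) ∎
  where
  open ≡-Reasoning
  rest = λ c → sumFin (λ k → x (suc k) * V (suc k) c)

-- The columns deleted by two successive expansions along the first row can be
-- removed in either order: deleting j and then (what becomes) k removes the same
-- two columns as deleting l and then m.
data Transposed : ∀ {n} → Fin (suc (suc n)) → Fin (suc n) → Fin (suc (suc n)) → Fin (suc n) → Set where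
  base : ∀ {n} (k : Fin (suc n)) → Transposed zero k (suc k) zero
  lift : ∀ {n} {j : Fin (suc (suc n))} {k l m} → Transposed j k l m → Transposed (suc j) (suc k) (suc l) (suc m)

Transposed-punchIn : ∀ {n} {j : Fin (suc (suc n))} {k l m} → Transposed j k l m →
                     punchIn j k ≡ l × punchIn l m ≡ j
Transposed-punchIn (base k) = refl , refl
Transposed-punchIn (lift t) with Transposed-punchIn t
... | p , q = cong suc p , cong suc q

Transposed-punchIn² : ∀ {n} {j : Fin (suc (suc n))} {k l m} → Transposed j k l m →
                      ∀ c → punchIn j (punchIn k c) ≡ punchIn l (punchIn m c)
Transposed-punchIn² (base k) c       = refl
Transposed-punchIn² (lift t) zero    = refl
Transposed-punchIn² (lift t) (suc c) = cong suc (Transposed-punchIn² t c)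

altSign-suc : ∀ k → altSign (suc k) ≡ - altSign k
altSign-suc zero          = refl
altSign-suc (suc zero)    = refl
altSign-suc (suc (suc k)) = altSign-suc k

-- In `base`, column 0 lies to the left of the other column, so deleting it first lowers the other
-- index by one; this single shift is the change of parity. `lift` shifts all four indices and
-- leaves both products unchanged.
Transposed-altSign : ∀ {n} {j : Fin (suc (suc n))} {k l m} → Transposed j k l m →
                     altSign (toℕ j) * altSign (toℕ k) ≡ - (altSign (toℕ l) * altSign (toℕ m))
Transposed-altSign (base k) rewrite altSign-suc (toℕ k) = lem (altSign (toℕ k))
  where
  lem : ∀ x → 1ℤ * x ≡ - (- x * 1ℤ)
  lem = solve-∀
Transposed-altSign (lift {j = j} {k} {l} {m} t)
  rewrite altSign-suc (toℕ j) | altSign-suc (toℕ k) | altSign-suc (toℕ l) | altSign-suc (toℕ m) =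
  trans (neg² (altSign (toℕ j)) (altSign (toℕ k)))
        (trans (Transposed-altSign t) (cong -_ (≡-sym (neg² (altSign (toℕ l)) (altSign (toℕ m))))))
  where
  neg² : ∀ x y → - x * - y ≡ x * y
  neg² = solve-∀

-- The row `F zero` cancels against the column of the entries `F (suc j) zero`; the remaining block
-- has the same shape, one size smaller.
sum-antisymmetric : ∀ {n} (F : Fin (suc (suc n)) → Fin (suc n) → ℤ) →
                    (∀ {j k l m} → Transposed j k l m → F j k ≡ - F l m) →
                    sumFin (λ j → sumFin (F j)) ≡ 0ℤ
sum-antisymmetric {n} F anti = begin
  sumFin (F zero) + sumFin (λ j → F (suc j) zero + sumFin (λ k → F (suc j) (suc k)))
    ≡⟨ cong (_+_ (sumFin (F zero))) (sum-+ (λ j → F (suc j) zero) (λ j → sumFin (λ k → F (suc j) (suc k)))) ⟩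
  sumFin (F zero) + (sumFin (λ j → F (suc j) zero) + sumFin (λ j → sumFin (λ k → F (suc j) (suc k))))
    ≡⟨ cong (λ x → sumFin (F zero) + (sumFin (λ j → F (suc j) zero) + x)) (inner n F anti) ⟩
  sumFin (F zero) + (sumFin (λ j → F (suc j) zero) + 0ℤ)
    ≡⟨ cong (_+_ (sumFin (F zero))) (ℤₚ.+-identityʳ _) ⟩
  sumFin (F zero) + sumFin (λ j → F (suc j) zero)
    ≡⟨ sum-+ (F zero) (λ j → F (suc j) zero) ⟨
  sumFin (λ j → F zero j + F (suc j) zero)
    ≡⟨ sum-zero (λ j → trans (cong (_+ F (suc j) zero) (anti (base j))) (ℤₚ.+-inverseˡ (F (suc j) zero))) ⟩
  0ℤ ∎
  where
  open ≡-Reasoning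
  inner : ∀ n (F : Fin (suc (suc n)) → Fin (suc n) → ℤ) →
          (∀ {j k l m} → Transposed j k l m → F j k ≡ - F l m) →
          sumFin (λ j → sumFin (λ k → F (suc j) (suc k))) ≡ 0ℤ
  inner zero    F anti = refl
  inner (suc n) F anti = sum-antisymmetric (λ j k → F (suc j) (suc k)) (anti ∘ lift)

-- Expanding twice gives a double sum over the ordered pairs of deleted columns. Exchanging the two
-- columns keeps the remaining minor and, the rows being equal, the product of the two entries, but
-- flips the sign.
det-equal-rows₀₁ : ∀ {n} (M : Matrix (suc (suc n))) → (∀ c → M zero c ≡ M (suc zero) c) → det M ≡ 0ℤ
det-equal-rows₀₁ {n} M eq =
  trans (sum-cong λ j → ≡-sym (sum-*ˡ (altSign (toℕ j) * M zero j)
           (λ k → altSign (toℕ k) * M (suc zero) (punchIn j k) * det (minor (minor M j) k))))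
        (sum-antisymmetric F anti)
  where
  F : Fin (suc (suc n)) → Fin (suc n) → ℤ
  F j k = altSign (toℕ j) * M zero j *
          (altSign (toℕ k) * M (suc zero) (punchIn j k) * det (minor (minor M j) k))
  gather : ∀ s x t y d → s * x * (t * y * d) ≡ s * t * (x * y * d)
  gather = solve-∀
  swapped : ∀ s x t y d → - (s * t) * (x * y * d) ≡ - (s * y * (t * x * d))
  swapped = solve-∀
  anti : ∀ {j k l m} → Transposed j k l m → F j k ≡ - F l m
  anti {j} {k} {l} {m} t = begin
    F j k
      ≡⟨ gather (altSign (toℕ j)) (M zero j) (altSign (toℕ k)) _ _ ⟩
    altSign (toℕ j) * altSign (toℕ k) * (M zero j * M (suc zero) (punchIn j k) * det (minor (minor M j) k))
      ≡⟨ cong₂ _*_ (Transposed-altSign t) (cong₂ _*_ (cong₂ _*_ eqⱼ eqₗ)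
                   (det-cong λ r c → cong (M (suc (suc r))) (Transposed-punchIn² t c))) ⟩
    - (altSign (toℕ l) * altSign (toℕ m)) * (M (suc zero) (punchIn l m) * M zero l * det (minor (minor M l) m))
      ≡⟨ swapped (altSign (toℕ l)) (M (suc zero) (punchIn l m)) (altSign (toℕ m)) (M zero l) _ ⟩
    - F l m ∎
    where
    open ≡-Reasoning
    eqⱼ = trans (eq j) (cong (M (suc zero)) (≡-sym (proj₂ (Transposed-punchIn t))))
    eqₗ = trans (cong (M (suc zero)) (proj₁ (Transposed-punchIn t))) (≡-sym (eq l))

EqualRowsVanish : ℕ → Set
EqualRowsVanish n = ∀ (M : Matrix n) {r s} → r ≢ s → (∀ c → M r c ≡ M s c) → det M ≡ 0ℤ

det-equal-rows-suc : ∀ {n} → EqualRowsVanish n → ∀ (M : Matrix (suc n)) {r s} → r ≢ s →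
                     (∀ c → M (suc r) c ≡ M (suc s) c) → det M ≡ 0ℤ
det-equal-rows-suc ih M {r} {s} r≢s eq = sum-zero λ j →
  trans (cong (_*_ (altSign (toℕ j) * M zero j)) (ih (minor M j) r≢s (eq ∘ punchIn j)))
        (ℤₚ.*-zeroʳ (altSign (toℕ j) * M zero j))

det-equal-rows₀ : ∀ {n} → EqualRowsVanish n → ∀ (M : Matrix (suc n)) s → (∀ c → M zero c ≡ M (suc s) c) → det M ≡ 0ℤ
det-equal-rows₀ {suc n} ih M zero    eq = det-equal-rows₀₁ M eq
-- Polarisation: rows 1 and s+2 may be exchanged at the cost of a sign.
det-equal-rows₀ {suc n} ih M (suc s) eq = begin
  det M              ≡⟨ det-cong (λ i c → cong (λ f → f c) (≡-sym (restore i))) ⟩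
  N u v              ≡⟨ ℤₚ.+-identityʳ (N u v) ⟨
  N u v + 0ℤ         ≡⟨ cong (_+_ (N u v)) swapped ⟨
  N u v + N v u      ≡⟨ total ⟩
  0ℤ ∎
  where
  open ≡-Reasoning
  one = suc zero
  two = suc (suc s)
  u = M one
  v = M two
  one≢two : one ≢ two
  one≢two ()
  Mat : (Fin (suc (suc n)) → ℤ) → (Fin (suc (suc n)) → ℤ) → Matrix (suc (suc n))
  Mat x y = M [ one ≔ x ] [ two ≔ y ]
  N : (Fin (suc (suc n)) → ℤ) → (Fin (suc (suc n)) → ℤ) → ℤ
  N x y = det (Mat x y)
  w = λ c → 1ℤ * u c + 1ℤ * v c
  restore : ∀ i → Mat u v i ≡ M i
  restore i with two ≟ i
  ... | yes refl = ≔-at (M [ one ≔ u ]) two v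
  ... | no  neq  = trans (≔-off (M [ one ≔ u ]) v neq) (≔-id M one i)
  row-two : ∀ x y c → Mat x y two c ≡ y c
  row-two x y c = cong (λ f → f c) (≔-at (M [ one ≔ x ]) two y)
  -- Equal rows below row 0 survive in every minor, where the induction hypothesis applies.
  vanish : ∀ x → N x x ≡ 0ℤ
  vanish x = det-equal-rows-suc ih (Mat x x) {zero} {suc s} (λ ()) λ c → ≡-sym (row-two x x c)
  linearʳ : ∀ x → N x w ≡ 1ℤ * N x u + 1ℤ * N x v
  linearʳ x = det-linear (M [ one ≔ x ]) two 1ℤ 1ℤ u v
  commuted : ∀ x y → N x y ≡ det (M [ two ≔ y ] [ one ≔ x ])
  commuted x y = det-cong λ i c → cong (λ f → f c) (≔-comm M x y one≢two i)
  linearˡ : ∀ y → N w y ≡ 1ℤ * N u y + 1ℤ * N v y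
  linearˡ y = trans (commuted w y) (trans (det-linear (M [ two ≔ y ]) one 1ℤ 1ℤ u v)
    (cong₂ (λ a b → 1ℤ * a + 1ℤ * b) (≡-sym (commuted u y)) (≡-sym (commuted v y))))
  -- After the exchange, row 1 carries the old row `two`, which equals row 0: the adjacent case.
  swapped : N v u ≡ 0ℤ
  swapped = det-equal-rows₀₁ (Mat v u) eq
  expand : ∀ a b c d → 1ℤ * (1ℤ * a + 1ℤ * b) + 1ℤ * (1ℤ * c + 1ℤ * d) ≡ (a + d) + (b + c)
  expand = solve-∀
  total : N u v + N v u ≡ 0ℤ
  total = begin
    N u v + N v u                     ≡⟨ ℤₚ.+-identityˡ _ ⟨
    0ℤ + 0ℤ + (N u v + N v u)         ≡⟨ cong₂ (λ a b → a + b + (N u v + N v u)) (vanish u) (vanish v) ⟨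
    N u u + N v v + (N u v + N v u)   ≡⟨ expand (N u u) (N u v) (N v u) (N v v) ⟨
    1ℤ * (1ℤ * N u u + 1ℤ * N u v) + 1ℤ * (1ℤ * N v u + 1ℤ * N v v)
                                      ≡⟨ cong₂ (λ a b → 1ℤ * a + 1ℤ * b) (linearʳ u) (linearʳ v) ⟨
    1ℤ * N u w + 1ℤ * N v w           ≡⟨ linearˡ w ⟨
    N w w                             ≡⟨ vanish w ⟩
    0ℤ ∎

det-equal-rows : ∀ {n} → EqualRowsVanish n
det-equal-rows         M {zero}  {zero}  r≢s eq = contradiction refl r≢s
det-equal-rows {suc n} M {zero}  {suc s} r≢s eq = det-equal-rows₀ det-equal-rows M s eq
det-equal-rows {suc n} M {suc r} {zero}  r≢s eq = det-equal-rows₀ det-equal-rows M r (≡-sym ∘ eq)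
det-equal-rows {suc n} M {suc r} {suc s} r≢s eq = det-equal-rows-suc det-equal-rows M (r≢s ∘ cong suc) eq

-- Matrix algebra and directional derivatives of the determinant

infix 4 _≐_
_≐_ : ∀ {n} → Matrix n → Matrix n → Set
M ≐ N = ∀ i j → M i j ≡ N i j

infixl 7 _⊗_
_⊗_ : ∀ {n} → Matrix n → Matrix n → Matrix n
(M ⊗ N) i j = sumFin λ k → M i k * N k j

trace : ∀ {n} → Matrix n → ℤ
trace M = sumFin λ i → M i i

⊗-congˡ : ∀ {n} {M M′ : Matrix n} → M ≐ M′ → ∀ N → M ⊗ N ≐ M′ ⊗ N
⊗-congˡ eq N i j = sum-cong λ k → cong (_* N k j) (eq i k)

⊗-assoc : ∀ {n} (M N P : Matrix n) → (M ⊗ N) ⊗ P ≐ M ⊗ (N ⊗ P)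
⊗-assoc M N P i j = begin
  sumFin (λ k → sumFin (λ l → M i l * N l k) * P k j)
    ≡⟨ sum-cong (λ k → ≡-sym (sum-*ʳ (P k j) (λ l → M i l * N l k))) ⟩
  sumFin (λ k → sumFin (λ l → M i l * N l k * P k j))
    ≡⟨ sum-swap (λ k l → M i l * N l k * P k j) ⟩
  sumFin (λ l → sumFin (λ k → M i l * N l k * P k j))
    ≡⟨ sum-cong (λ l → trans (sum-cong λ k → ℤₚ.*-assoc (M i l) (N l k) (P k j)) (sum-*ˡ (M i l) (λ k → N l k * P k j))) ⟩
  sumFin (λ l → M i l * sumFin (λ k → N l k * P k j)) ∎
  where open ≡-Reasoning

⊗-identityʳ : ∀ {n} (M : Matrix n) → M ⊗ Id ≐ M
⊗-identityʳ M i j = sum-Idʳ j (M i)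

⊗-identityˡ : ∀ {n} (M : Matrix n) → Id ⊗ M ≐ M
⊗-identityˡ M i j = sum-Idˡ i (λ k → M k j)

Symmetric : ∀ {n} → Matrix n → Set
Symmetric M = ∀ i j → M i j ≡ M j i

⊗-transpose : ∀ {n} {M N : Matrix n} → Symmetric M → Symmetric N → ∀ i j → (M ⊗ N) i j ≡ (N ⊗ M) j i
⊗-transpose {M = M} {N} symM symN i j =
  sum-cong λ k → trans (ℤₚ.*-comm (M i k) (N k j)) (cong₂ _*_ (symN k j) (symM i k))

-- Expanding each summand along its replaced row gives tr(E adj M), Jacobi's formula, without an
-- adjugate ever being formed.
detDeriv : ∀ {n} → Matrix n → Matrix n → ℤ
detDeriv M E = sumFin λ i → det (M [ i ≔ E i ])

detDeriv-cong : ∀ {n} (M : Matrix n) {E F : Matrix n} → E ≐ F → detDeriv M E ≡ detDeriv M F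
detDeriv-cong M E≐F = sum-cong λ i → det-cong (≔-cong i (λ _ _ → refl) (E≐F i))

detDeriv-linear : ∀ {n} (M : Matrix n) x y (E F : Matrix n) →
                  detDeriv M (λ i j → x * E i j + y * F i j) ≡ x * detDeriv M E + y * detDeriv M F
detDeriv-linear M x y E F =
  trans (sum-cong λ i → det-linear M i x y (E i) (F i))
        (sum-linear x y (λ i → det (M [ i ≔ E i ])) (λ i → det (M [ i ≔ F i ])))

det-copy-row : ∀ {n} (M : Matrix n) i k → det (M [ i ≔ M k ]) ≡ det M * Id k i
det-copy-row M i k with i ≟ k
... | yes refl = trans (det-cong λ r c → cong (λ f → f c) (≔-id M i r))
                       (trans (≡-sym (ℤₚ.*-identityʳ (det M))) (cong (det M *_) (≡-sym (Id-diag i))))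
... | no  i≢k  = trans (det-equal-rows (M [ i ≔ M k ]) i≢k λ c →
                          cong (λ f → f c) (trans (≔-at M i (M k)) (≡-sym (≔-off M (M k) i≢k))))
                       (trans (≡-sym (ℤₚ.*-zeroʳ (det M))) (cong (det M *_) (≡-sym (Id-off (i≢k ∘ ≡-sym)))))

-- Row i of `C ⊗ M` is a combination of the rows of `M`. A copy of any other row produces two equal
-- rows, so only the coefficient `C i i` survives. In terms of the adjugate this is M adj(M) =
-- det(M) I.
detDeriv-⊗ : ∀ {n} (C M : Matrix n) → detDeriv M (C ⊗ M) ≡ trace C * det M
detDeriv-⊗ C M = trans (sum-cong row) (sum-*ʳ (det M) (λ i → C i i))
  where
  open ≡-Reasoning
  shuffle : ∀ c d e → c * (d * e) ≡ c * e * d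
  shuffle = solve-∀
  row : ∀ i → det (M [ i ≔ (C ⊗ M) i ]) ≡ C i i * det M
  row i = begin
    det (M [ i ≔ (λ c → sumFin (λ k → C i k * M k c)) ]) ≡⟨ det-linear-sum M i (C i) M ⟩
    sumFin (λ k → C i k * det (M [ i ≔ M k ]))           ≡⟨ sum-cong (λ k → trans (cong (C i k *_) (det-copy-row M i k)) (shuffle (C i k) (det M) (Id k i))) ⟩
    sumFin (λ k → C i k * Id k i * det M)                ≡⟨ sum-*ʳ (det M) (λ k → C i k * Id k i) ⟩
    sumFin (λ k → C i k * Id k i) * det M                ≡⟨ cong (_* det M) (sum-Idʳ i (C i)) ⟩
    C i i * det M ∎

-- Induction along the first row, with the product rule for each term. The remainder is an arbitrary
-- integer-valued function of `h`: its integrality is all that `derivative-unique` exploits.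
det-taylor : ∀ {n} (M E : Matrix n) → Σ (ℤ → ℤ) λ r → ∀ h →
             det (λ i j → M i j + h * E i j) ≡ det M + h * detDeriv M E + h * h * r h
det-taylor {zero}  M E = (λ _ → 0ℤ) , λ h → lem h
  where
  lem : ∀ h → 1ℤ ≡ 1ℤ + h * 0ℤ + h * h * 0ℤ
  lem = solve-∀
det-taylor {suc n} M E = r , λ h → begin
  sumFin (λ j → s j * (M zero j + h * E zero j) * det (λ i k → minor M j i k + h * minor E j i k))
    ≡⟨ sum-cong (λ j → cong (s j * (M zero j + h * E zero j) *_) (proj₂ (ih j) h)) ⟩
  sumFin (λ j → s j * (M zero j + h * E zero j) * (m j + h * d j + h * h * proj₁ (ih j) h))
    ≡⟨ sum-cong (λ j → expand (s j) (M zero j) (E zero j) h (m j) (d j) (proj₁ (ih j) h)) ⟩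
  sumFin (λ j → s j * M zero j * m j + h * (s j * E zero j * m j + s j * M zero j * d j) + h * h * rest h j)
    ≡⟨ sum-+ (λ j → s j * M zero j * m j + h * (s j * E zero j * m j + s j * M zero j * d j)) (λ j → h * h * rest h j) ⟩
  sumFin (λ j → s j * M zero j * m j + h * (s j * E zero j * m j + s j * M zero j * d j)) + sumFin (λ j → h * h * rest h j)
    ≡⟨ cong₂ _+_ (sum-+ (λ j → s j * M zero j * m j) (λ j → h * (s j * E zero j * m j + s j * M zero j * d j))) (sum-*ˡ (h * h) (rest h)) ⟩
  det M + sumFin (λ j → h * (s j * E zero j * m j + s j * M zero j * d j)) + h * h * r h
    ≡⟨ cong (λ x → det M + x + h * h * r h) (trans (sum-*ˡ h (λ j → s j * E zero j * m j + s j * M zero j * d j)) (cong (h *_) deriv)) ⟩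
  det M + h * detDeriv M E + h * h * r h ∎
  where
  open ≡-Reasoning
  s : Fin (suc n) → ℤ
  s j = altSign (toℕ j)
  m d : Fin (suc n) → ℤ
  m j = det (minor M j)
  d j = detDeriv (minor M j) (minor E j)
  ih = λ j → det-taylor (minor M j) (minor E j)
  rest : ℤ → Fin (suc n) → ℤ
  rest h j = s j * E zero j * d j + s j * (M zero j + h * E zero j) * proj₁ (ih j) h
  r : ℤ → ℤ
  r h = sumFin (rest h)
  expand : ∀ s x e h m d r → s * (x + h * e) * (m + h * d + h * h * r) ≡
           s * x * m + h * (s * e * m + s * x * d) + h * h * (s * e * d + s * (x + h * e) * r)
  expand = solve-∀
  deriv : sumFin (λ j → s j * E zero j * m j + s j * M zero j * d j) ≡ detDeriv M E
  deriv = begin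
    sumFin (λ j → s j * E zero j * m j + s j * M zero j * d j)
      ≡⟨ sum-+ (λ j → s j * E zero j * m j) (λ j → s j * M zero j * d j) ⟩
    det (M [ zero ≔ E zero ]) + sumFin (λ j → s j * M zero j * d j)
      ≡⟨ cong (_+_ (det (M [ zero ≔ E zero ]))) (sum-cong λ j → ≡-sym (trans
           (sum-cong λ i → cong (s j * M zero j *_) (det-minor-≔ M i (E (suc i)) j))
           (sum-*ˡ (s j * M zero j) (λ i → det (minor M j [ i ≔ minor E j i ]))))) ⟩
    det (M [ zero ≔ E zero ]) + sumFin (λ j → sumFin (λ i → s j * M zero j * det (minor (M [ suc i ≔ E (suc i) ]) j)))
      ≡⟨ cong (_+_ (det (M [ zero ≔ E zero ]))) (sum-swap (λ j i → s j * M zero j * det (minor (M [ suc i ≔ E (suc i) ]) j))) ⟩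
    detDeriv M E ∎

-- Diagonal scaling and the characteristic polynomial

product : ∀ {n} → (Fin n → ℤ) → ℤ
product {zero}  f = 1ℤ
product {suc n} f = f zero * product (f ∘ suc)

product-punchIn : ∀ {n} (f : Fin (suc n) → ℤ) j → f j * product (f ∘ punchIn j) ≡ product f
product-punchIn f zero = refl
product-punchIn {suc n} f (suc j) =
  trans (exchange (f (suc j)) (f zero) _) (cong (f zero *_) (product-punchIn (f ∘ suc) j))
  where
  exchange : ∀ x y z → x * (y * z) ≡ y * (x * z)
  exchange = solve-∀

det-scale : ∀ {n} (x y : Fin n → ℤ) (M : Matrix n) →
            det (λ i j → x i * y j * M i j) ≡ product x * product y * det M
det-scale {zero}  x y M = refl
det-scale {suc n} x y M = trans (sum-cong term) (sum-*ˡ (product x * product y) (λ j → altSign (toℕ j) * M zero j * det (minor M j)))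
  where
  open ≡-Reasoning
  rearrange : ∀ s x y m px py d → s * (x * y * m) * (px * py * d) ≡ x * px * (y * py) * (s * m * d)
  rearrange = solve-∀
  term : ∀ j → altSign (toℕ j) * (x zero * y j * M zero j) * det (λ r c → x (suc r) * y (punchIn j c) * minor M j r c)
             ≡ product x * product y * (altSign (toℕ j) * M zero j * det (minor M j))
  term j = begin
    s * (x zero * y j * M zero j) * det (λ r c → x (suc r) * y (punchIn j c) * minor M j r c)
      ≡⟨ cong (s * (x zero * y j * M zero j) *_) (det-scale (x ∘ suc) (y ∘ punchIn j) (minor M j)) ⟩
    s * (x zero * y j * M zero j) * (product (x ∘ suc) * product (y ∘ punchIn j) * det (minor M j))
      ≡⟨ rearrange s (x zero) (y j) (M zero j) (product (x ∘ suc)) (product (y ∘ punchIn j)) (det (minor M j)) ⟩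
    product x * (y j * product (y ∘ punchIn j)) * (s * M zero j * det (minor M j))
      ≡⟨ cong (λ p → product x * p * (s * M zero j * det (minor M j))) (product-punchIn y j) ⟩
    product x * product y * (s * M zero j * det (minor M j)) ∎
    where s = altSign (toℕ j)

product-square : ∀ {n} (x : Fin n → ℤ) → (∀ i → x i * x i ≡ 1ℤ) → product x * product x ≡ 1ℤ
product-square {zero}  x eq = refl
product-square {suc n} x eq = trans (interchange (x zero) (product (x ∘ suc)))
                                    (cong₂ _*_ (eq zero) (product-square (x ∘ suc) (eq ∘ suc)))
  where
  interchange : ∀ a b → a * b * (a * b) ≡ a * a * (b * b)
  interchange = solve-∀

charMatrix : ∀ {n} → Matrix n → ℤ → Matrix n
charMatrix A t i j = (if does (i ≟ j) then t else + 0) - A i j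

charMatrix-Id : ∀ {n} (A : Matrix n) t → charMatrix A t ≐ λ i j → t * Id i j - A i j
charMatrix-Id A t i j = cong (_- A i j) (lem (does (i ≟ j)))
  where
  lem : ∀ b → (if b then t else + 0) ≡ t * (if b then 1ℤ else 0ℤ)
  lem true  = ≡-sym (ℤₚ.*-identityʳ t)
  lem false = ≡-sym (ℤₚ.*-zeroʳ t)

-- A diagonal matrix of signs is its own inverse, so this is invariance under similarity. Switching
-- acts on adjacency matrices in just this way, which carries the spectral condition over to the
-- unsigned graph.
charPolyAt-conjugate : ∀ {n} (A : Matrix n) (ε : Fin n → ℤ) → (∀ i → ε i * ε i ≡ 1ℤ) → ∀ t →
                       charPolyAt (λ i j → ε i * ε j * A i j) t ≡ charPolyAt A t
charPolyAt-conjugate A ε ε²≡1 t = begin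
  det (charMatrix (λ i j → ε i * ε j * A i j) t)   ≡⟨ det-cong entry ⟩
  det (λ i j → ε i * ε j * charMatrix A t i j)     ≡⟨ det-scale ε ε (charMatrix A t) ⟩
  product ε * product ε * charPolyAt A t           ≡⟨ cong (_* charPolyAt A t) (product-square ε ε²≡1) ⟩
  1ℤ * charPolyAt A t                              ≡⟨ ℤₚ.*-identityˡ _ ⟩
  charPolyAt A t ∎
  where
  open ≡-Reasoning
  distrib : ∀ e x a → e * x - e * a ≡ e * (x - a)
  distrib = solve-∀
  scaled : ∀ {i j} → Dec (i ≡ j) → t * Id i j ≡ ε i * ε j * (t * Id i j)
  scaled {i} (yes refl) = ≡-sym (trans (cong (_* (t * Id i i)) (ε²≡1 i)) (ℤₚ.*-identityˡ _))
  scaled {i} {j} (no i≢j) = trans t*Id≡0 (≡-sym (trans (cong (ε i * ε j *_) t*Id≡0) (ℤₚ.*-zeroʳ (ε i * ε j))))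
    where t*Id≡0 = trans (cong (t *_) (Id-off i≢j)) (ℤₚ.*-zeroʳ t)
  entry : ∀ i j → charMatrix (λ i j → ε i * ε j * A i j) t i j ≡ ε i * ε j * charMatrix A t i j
  entry i j = begin
    charMatrix (λ i j → ε i * ε j * A i j) t i j      ≡⟨ charMatrix-Id (λ i j → ε i * ε j * A i j) t i j ⟩
    t * Id i j - ε i * ε j * A i j                    ≡⟨ cong (_- ε i * ε j * A i j) (scaled (i ≟ j)) ⟩
    ε i * ε j * (t * Id i j) - ε i * ε j * A i j      ≡⟨ distrib (ε i * ε j) (t * Id i j) (A i j) ⟩
    ε i * ε j * (t * Id i j - A i j)                  ≡⟨ cong (ε i * ε j *_) (charMatrix-Id A t i j) ⟨
    ε i * ε j * charMatrix A t i j ∎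

-- Degree bounds and derivatives

at : ℕ → ℤ
at s = + suc s

-- Arguments are shifted by one so that all powers of the argument are positive.
record O (k : ℕ) (f : ℕ → ℤ) : Set where
  constructor _,_
  field
    constant : ℕ
    bound    : ∀ s → ∣ f s ∣ ℕ.≤ constant ℕ.* suc s ℕ.^ k

O-cong : ∀ {k f g} → (∀ s → f s ≡ g s) → O k f → O k g
O-cong eq (K , bound) = K , λ s → subst (λ x → ∣ x ∣ ℕ.≤ K ℕ.* _) (eq s) (bound s)

O-const : ∀ x → O 0 (λ _ → x)
O-const x = ∣ x ∣ , λ s → ℕₚ.≤-reflexive (≡-sym (ℕₚ.*-identityʳ ∣ x ∣))

O-at : O 1 at
O-at = 1 , λ s → ℕₚ.≤-reflexive (≡-sym (trans (ℕₚ.*-identityˡ _) (ℕₚ.*-identityʳ (suc s))))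

O-zero : ∀ k → O k (λ _ → 0ℤ)
O-zero k = 0 , λ s → z≤n

O-weaken : ∀ {k f} → O k f → O (suc k) f
O-weaken {k} (K , bound) = K , λ s → ℕₚ.≤-trans (bound s) (ℕₚ.*-monoʳ-≤ K (ℕₚ.m≤n*m (suc s ℕ.^ k) (suc s)))

O-+ : ∀ {k f g} → O k f → O k g → O k (λ s → f s + g s)
O-+ {k} {f} {g} (K , boundf) (L , boundg) = K ℕ.+ L , λ s → begin
  ∣ f s + g s ∣                                        ≤⟨ ℤₚ.∣i+j∣≤∣i∣+∣j∣ (f s) (g s) ⟩
  ∣ f s ∣ ℕ.+ ∣ g s ∣                                  ≤⟨ ℕₚ.+-mono-≤ (boundf s) (boundg s) ⟩
  K ℕ.* suc s ℕ.^ k ℕ.+ L ℕ.* suc s ℕ.^ k              ≡⟨ ℕₚ.*-distribʳ-+ (suc s ℕ.^ k) K L ⟨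
  (K ℕ.+ L) ℕ.* suc s ℕ.^ k                            ∎
  where open ℕₚ.≤-Reasoning

O-* : ∀ {k l f g} → O k f → O l g → O (k ℕ.+ l) (λ s → f s * g s)
O-* {k} {l} {f} {g} (K , boundf) (L , boundg) = K ℕ.* L , λ s → begin
  ∣ f s * g s ∣                                        ≡⟨ ℤₚ.abs-* (f s) (g s) ⟩
  ∣ f s ∣ ℕ.* ∣ g s ∣                                  ≤⟨ ℕₚ.*-mono-≤ (boundf s) (boundg s) ⟩
  K ℕ.* suc s ℕ.^ k ℕ.* (L ℕ.* suc s ℕ.^ l)            ≡⟨ ℕₚ.[m*n]*[o*p]≡[m*o]*[n*p] K (suc s ℕ.^ k) L (suc s ℕ.^ l) ⟩
  K ℕ.* L ℕ.* (suc s ℕ.^ k ℕ.* suc s ℕ.^ l)            ≡⟨ cong (K ℕ.* L ℕ.*_) (ℕₚ.^-distribˡ-+-* (suc s) k l) ⟨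
  K ℕ.* L ℕ.* suc s ℕ.^ (k ℕ.+ l)                      ∎
  where open ℕₚ.≤-Reasoning

O-sum : ∀ {n k} {f : ℕ → Fin n → ℤ} → (∀ i → O k (λ s → f s i)) → O k (λ s → sumFin (f s))
O-sum {zero}  bound = O-zero _
O-sum {suc n} bound = O-+ (bound zero) (O-sum (bound ∘ suc))

det-O : ∀ {n} (M : ℕ → Matrix n) → (∀ i j → O 1 (λ s → M s i j)) → O n (λ s → det (M s))
det-O {zero}  M bound = O-const 1ℤ
det-O {suc n} M bound = O-sum λ j →
  O-* (O-* (O-const (altSign (toℕ j))) (bound zero j))
      (det-O (λ s → minor (M s) j) λ r c → bound (suc r) (punchIn j c))

-- The constant row contributes no factor t, which saves one degree. This makes the degree of D(C)
-- smaller than that of p.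
det-O-const-row : ∀ {n} (M : ℕ → Matrix (suc n)) → (∀ i j → O 1 (λ s → M s i j)) →
                  ∀ i (v : Fin (suc n) → ℤ) → O n (λ s → det (M s [ i ≔ v ]))
det-O-const-row {n} M bound zero v = O-sum λ j →
  O-* (O-* (O-const (altSign (toℕ j))) (O-const (v j)))
      (det-O (λ s → minor (M s) j) λ r c → bound (suc r) (punchIn j c))
det-O-const-row {suc n} M bound (suc i) v = O-sum λ j →
  O-* (O-* (O-const (altSign (toℕ j))) (bound zero j))
      (O-cong (λ s → ≡-sym (det-minor-≔ (M s) i v j))
              (det-O-const-row (λ s → minor (M s) j) (λ r c → bound (suc r) (punchIn j c)) i (v ∘ punchIn j)))

charMatrix-O : ∀ {n} (A : Matrix n) i j → O 1 (λ s → charMatrix A (at s) i j)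
charMatrix-O A i j = O-+ (diag (does (i ≟ j))) (O-weaken (O-const (- A i j)))
  where
  diag : ∀ b → O 1 (λ s → if b then at s else + 0)
  diag true  = O-at
  diag false = O-zero 1

detDeriv-O : ∀ {n} (A C : Matrix (suc n)) → O n (λ s → detDeriv (charMatrix A (at s)) C)
detDeriv-O A C = O-sum λ i → det-O-const-row (λ s → charMatrix A (at s)) (charMatrix-O A) i (C i)

-- In the first row only the diagonal entry contains t; every other term is a constant times a minor
-- of size n.
charPolyAt-expand : ∀ {n} (A : Matrix (suc n)) →
                    O n (λ s → charPolyAt A (at s) - at s * charPolyAt (λ i j → A (suc i) (suc j)) (at s))
charPolyAt-expand {n} A = O-cong
  (λ s → lem (at s) (A zero zero) (charPolyAt (λ i j → A (suc i) (suc j)) (at s)) (rest s))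
  (O-+ (O-* (O-const (- A zero zero)) (minor-O zero)) (O-sum λ j →
     O-* (O-* (O-const (altSign (toℕ (suc j)))) (O-const (0ℤ - A zero (suc j)))) (minor-O (suc j))))
  where
  minor-O : ∀ j → O n (λ s → det (minor (charMatrix A (at s)) j))
  minor-O j = det-O (λ s → minor (charMatrix A (at s)) j) λ r c → charMatrix-O A (suc r) (punchIn j c)
  rest : ℕ → ℤ
  rest s = sumFin λ j → altSign (toℕ (suc j)) * (0ℤ - A zero (suc j)) * det (minor (charMatrix A (at s)) (suc j))
  lem : ∀ t a p r → - a * p + r ≡ 1ℤ * (t - a) * p + r - t * p
  lem = solve-∀

-- The extra factor `at s` says that p - t^n has degree below n without subtracting 1 from the
-- exponent, so that n = 0 is covered too.
charPolyAt-monic : ∀ {n} (A : Matrix n) → O n (λ s → at s * (charPolyAt A (at s) - at s ^ n))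
charPolyAt-monic {zero}  A = O-cong (λ s → ≡-sym (ℤₚ.*-zeroʳ (at s))) (O-zero 0)
charPolyAt-monic {suc n} A = O-cong
  (λ s → lem (at s) (charPolyAt A (at s)) (charPolyAt (λ i j → A (suc i) (suc j)) (at s)) (at s ^ n))
  (O-+ (O-* O-at (charPolyAt-expand A)) (O-* O-at (charPolyAt-monic (λ i j → A (suc i) (suc j)))))
  where
  lem : ∀ t p q x → t * (p - t * q) + t * (t * (q - x)) ≡ t * (p - t * x)
  lem = solve-∀

abs-^ : ∀ m k → ∣ (+ m) ^ k ∣ ≡ m ℕ.^ k
abs-^ m zero    = refl
abs-^ m (suc k) = trans (ℤₚ.abs-* (+ m) ((+ m) ^ k)) (cong (m ℕ.*_) (abs-^ m k))

-- Vanishing at all large integers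

Eventually : (ℕ → Set) → Set
Eventually P = Σ ℕ λ S → ∀ s → S ℕ.≤ s → P s

eventually-zip : ∀ {P Q R : ℕ → Set} → (∀ s → P s → Q s → R s) → Eventually P → Eventually Q → Eventually R
eventually-zip f (S , p) (T , q) =
  S ℕ.+ T , λ s S+T≤s → f s (p s (ℕₚ.≤-trans (ℕₚ.m≤m+n S T) S+T≤s)) (q s (ℕₚ.≤-trans (ℕₚ.m≤n+m T S) S+T≤s))

-- Here `N` stands for t^n and `x` for t^(n+1). A nonzero `e` forces |p| ≤ |d|; then t · tN = |t x|
-- is at most (K + L) · tN, against K + L < t.
dominated : ∀ t N K L (p x d e : ℤ) .{{_ : ℕ.NonZero t}} .{{_ : ℕ.NonZero N}} →
            ∣ d ∣ ℕ.≤ K ℕ.* N → ∣ x ∣ ≡ t ℕ.* N → ∣ + t * (p - x) ∣ ℕ.≤ L ℕ.* (t ℕ.* N) → K ℕ.+ L ℕ.< t →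
            p * e ≡ d → e ≡ 0ℤ
dominated t N K L p x d e d≤ ∣x∣≡ near large eq = ℤₚ.∣i∣≡0⇒i≡0 (small ∣ e ∣ refl)
  where
  open ℕₚ.≤-Reasoning
  rearr : ∀ t p x → t * x ≡ t * p - t * (p - x)
  rearr = solve-∀
  tp≤ : ∣ p ∣ ℕ.≤ ∣ d ∣ → ∣ + t * p ∣ ℕ.≤ K ℕ.* (t ℕ.* N)
  tp≤ p≤d = begin
    ∣ + t * p ∣                ≡⟨ ℤₚ.abs-* (+ t) p ⟩
    t ℕ.* ∣ p ∣                ≤⟨ ℕₚ.*-monoʳ-≤ t (ℕₚ.≤-trans p≤d d≤) ⟩
    t ℕ.* (K ℕ.* N)            ≡⟨ ℕₚ.*-assoc t K N ⟨
    t ℕ.* K ℕ.* N              ≡⟨ cong (ℕ._* N) (ℕₚ.*-comm t K) ⟩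
    K ℕ.* t ℕ.* N              ≡⟨ ℕₚ.*-assoc K t N ⟩
    K ℕ.* (t ℕ.* N)            ∎
  absurd : ∣ p ∣ ℕ.≤ ∣ d ∣ → t ℕ.* (t ℕ.* N) ℕ.≤ (K ℕ.+ L) ℕ.* (t ℕ.* N)
  absurd p≤d = begin
    t ℕ.* (t ℕ.* N)                            ≡⟨ cong (t ℕ.*_) ∣x∣≡ ⟨
    t ℕ.* ∣ x ∣                                ≡⟨ ℤₚ.abs-* (+ t) x ⟨
    ∣ + t * x ∣                                ≡⟨ cong ∣_∣ (rearr (+ t) p x) ⟩
    ∣ + t * p - + t * (p - x) ∣                ≤⟨ ℤₚ.∣i-j∣≤∣i∣+∣j∣ (+ t * p) (+ t * (p - x)) ⟩
    ∣ + t * p ∣ ℕ.+ ∣ + t * (p - x) ∣          ≤⟨ ℕₚ.+-mono-≤ (tp≤ p≤d) near ⟩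
    K ℕ.* (t ℕ.* N) ℕ.+ L ℕ.* (t ℕ.* N)        ≡⟨ ℕₚ.*-distribʳ-+ (t ℕ.* N) K L ⟨
    (K ℕ.+ L) ℕ.* (t ℕ.* N)                    ∎
  small : ∀ k → ∣ e ∣ ≡ k → k ≡ 0
  small zero    ∣e∣≡k = refl
  small (suc k) ∣e∣≡k = contradiction
    (ℕₚ.*-cancelʳ-≤ t (K ℕ.+ L) (t ℕ.* N) {{ℕₚ.m*n≢0 t N}} (absurd (begin
      ∣ p ∣            ≤⟨ ℕₚ.m≤m*n ∣ p ∣ (suc k) ⟩
      ∣ p ∣ ℕ.* suc k  ≡⟨ cong (∣ p ∣ ℕ.*_) ∣e∣≡k ⟨
      ∣ p ∣ ℕ.* ∣ e ∣  ≡⟨ ℤₚ.abs-* p e ⟨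
      ∣ p * e ∣        ≡⟨ cong ∣_∣ eq ⟩
      ∣ d ∣            ∎)))
    (ℕₚ.<⇒≱ large)

-- A multiple of a monic polynomial that has smaller degree is zero. The cofactor `e` is quantified
-- after the threshold, so it may itself vary with `s` and grow without bound.
monic-dominates : ∀ {n} {p d : ℕ → ℤ} → O (suc n) (λ s → at s * (p s - at s ^ suc n)) → O n d →
                  Eventually λ s → ∀ e → p s * e ≡ d s → e ≡ 0ℤ
monic-dominates {n} {p} {d} (L , monic) (K , bound) = K ℕ.+ L , λ s large e →
  dominated (suc s) (suc s ℕ.^ n) K L (p s) (at s ^ suc n) (d s) e {{_}} {{ℕₚ.m^n≢0 (suc s) n}}
            (bound s) (abs-^ (suc s) (suc n)) (monic s) (s≤s large)

multiple-small : ∀ t r x → x + + t * r ≡ 0ℤ → ∣ x ∣ ℕ.< t → r ≡ 0ℤ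
multiple-small t r x eq x<t = ℤₚ.∣i∣≡0⇒i≡0 (small ∣ r ∣ refl)
  where
  open ℕₚ.≤-Reasoning
  solve-x : ∀ x y → x ≡ x + y - y
  solve-x = solve-∀
  x≡ : x ≡ 0ℤ - + t * r
  x≡ = trans (solve-x x (+ t * r)) (cong (_- + t * r) eq)
  small : ∀ k → ∣ r ∣ ≡ k → k ≡ 0
  small zero    _     = refl
  small (suc k) ∣r∣≡k = contradiction (begin
    t                  ≤⟨ ℕₚ.m≤m*n t (suc k) ⟩
    t ℕ.* suc k        ≡⟨ cong (t ℕ.*_) ∣r∣≡k ⟨
    t ℕ.* ∣ r ∣        ≡⟨ ℤₚ.abs-* (+ t) r ⟨
    ∣ + t * r ∣        ≡⟨ ℤₚ.∣-i∣≡∣i∣ (+ t * r) ⟨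
    ∣ - (+ t * r) ∣    ≡⟨ cong ∣_∣ (ℤₚ.+-identityˡ (- (+ t * r))) ⟨
    ∣ 0ℤ - + t * r ∣   ≡⟨ cong ∣_∣ x≡ ⟨
    ∣ x ∣              ∎) (ℕₚ.<⇒≱ x<t)

-- One Horner step of "a polynomial vanishing at all large integers is zero".
horner-vanish : ∀ x (r : ℕ → ℤ) → Eventually (λ s → x + at s * r s ≡ 0ℤ) →
                x ≡ 0ℤ × Eventually (λ s → r s ≡ 0ℤ)
horner-vanish x r (S , eq) = x≡0 , (S ℕ.+ ∣ x ∣ , r≡0)
  where
  r≡0 : ∀ s → S ℕ.+ ∣ x ∣ ℕ.≤ s → r s ≡ 0ℤ
  r≡0 s large = multiple-small (suc s) (r s) x (eq s (ℕₚ.≤-trans (ℕₚ.m≤m+n S ∣ x ∣) large))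
                               (s≤s (ℕₚ.≤-trans (ℕₚ.m≤n+m ∣ x ∣ S) large))
  s₀ = S ℕ.+ ∣ x ∣
  x≡0 : x ≡ 0ℤ
  x≡0 = trans (≡-sym (trans (cong (λ y → x + at s₀ * y) (r≡0 s₀ ℕₚ.≤-refl))
                            (trans (cong (_+_ x) (ℤₚ.*-zeroʳ (at s₀))) (ℤₚ.+-identityʳ x))))
              (eq s₀ (ℕₚ.m≤m+n S ∣ x ∣))

-- Apply `detDeriv-⊗` to C (tI - A) = t C - C A.
detDeriv-⊗A : ∀ {n} (A C : Matrix n) t →
              detDeriv (charMatrix A t) (C ⊗ A) ≡ t * detDeriv (charMatrix A t) C - trace C * charPolyAt A t
detDeriv-⊗A A C t = begin
  D (C ⊗ A)                                 ≡⟨ isolate t (D C) (D (C ⊗ A)) ⟩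
  t * D C - (t * D C + -1ℤ * D (C ⊗ A))     ≡⟨ cong (_-_ (t * D C)) (detDeriv-linear (charMatrix A t) t -1ℤ C (C ⊗ A)) ⟨
  t * D C - D (λ i j → t * C i j + -1ℤ * (C ⊗ A) i j)
                                            ≡⟨ cong (_-_ (t * D C)) (detDeriv-cong (charMatrix A t) split) ⟨
  t * D C - D (C ⊗ charMatrix A t)          ≡⟨ cong (_-_ (t * D C)) (detDeriv-⊗ C (charMatrix A t)) ⟩
  t * D C - trace C * charPolyAt A t        ∎
  where
  open ≡-Reasoning
  D = detDeriv (charMatrix A t)
  isolate : ∀ t x y → y ≡ t * x - (t * x + -1ℤ * y)
  isolate = solve-∀
  distrib : ∀ c t i a → c * (t * i - a) ≡ t * (c * i) + -1ℤ * (c * a)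
  distrib = solve-∀
  split : C ⊗ charMatrix A t ≐ λ i j → t * C i j + -1ℤ * (C ⊗ A) i j
  split i j = begin
    sumFin (λ k → C i k * charMatrix A t k j)
      ≡⟨ sum-cong (λ k → trans (cong (C i k *_) (charMatrix-Id A t k j)) (distrib (C i k) t (Id k j) (A k j))) ⟩
    sumFin (λ k → t * (C i k * Id k j) + -1ℤ * (C i k * A k j))
      ≡⟨ sum-linear t -1ℤ (λ k → C i k * Id k j) (λ k → C i k * A k j) ⟩
    t * (C ⊗ Id) i j + -1ℤ * (C ⊗ A) i j
      ≡⟨ cong (λ x → t * x + -1ℤ * (C ⊗ A) i j) (⊗-identityʳ C i j) ⟩
    t * C i j + -1ℤ * (C ⊗ A) i j ∎

-- Differentiability in the sense of an exact first-order expansion with integral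
-- remainder, which determines the derivative without limits.
record HasDerivative (f : ℤ → ℤ) (t f′ : ℤ) : Set where
  constructor _,_
  field
    remainder : ℤ → ℤ
    expansion : ∀ h → f (t + h) ≡ f t + h * f′ + h * h * remainder h

derivative-unique : ∀ {f t d e} → HasDerivative f t d → HasDerivative f t e → d ≡ e
derivative-unique {f} {t} {d} {e} (r , eqr) (q , eqq) = ℤₚ.i-j≡0⇒i≡j d e d-e≡0
  where
  -- For this step size the two expansions make d - e a multiple of `h` whose absolute value is
  -- below `h`.
  k = suc ∣ d - e ∣
  h = + k
  open ≡-Reasoning
  combine : ∀ x d e h r q → h * (d - e + h * (r - q)) ≡ (x + h * d + h * h * r) - (x + h * e + h * h * q)
  combine = solve-∀
  h*≡0 : h * (d - e + h * (r h - q h)) ≡ 0ℤ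
  h*≡0 = trans (combine (f t) d e h (r h) (q h))
               (trans (cong₂ _-_ (≡-sym (eqr h)) (≡-sym (eqq h))) (ℤₚ.+-inverseʳ (f (t + h))))
  ≡0 : d - e + h * (r h - q h) ≡ 0ℤ
  ≡0 with ℤₚ.i*j≡0⇒i≡0∨j≡0 h h*≡0
  ... | inj₂ eq = eq
  d-e≡0 : d - e ≡ 0ℤ
  d-e≡0 = begin
    d - e                             ≡⟨ ℤₚ.+-identityʳ (d - e) ⟨
    d - e + 0ℤ                        ≡⟨ cong (_+_ (d - e)) (ℤₚ.*-zeroʳ h) ⟨
    d - e + h * 0ℤ                    ≡⟨ cong (λ x → d - e + h * x) (multiple-small k (r h - q h) (d - e) ≡0 ℕₚ.≤-refl) ⟨
    d - e + h * (r h - q h)           ≡⟨ ≡0 ⟩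
    0ℤ ∎

derivative-resp : ∀ {f g t d} → (∀ t → f t ≡ g t) → HasDerivative f t d → HasDerivative g t d
derivative-resp {f} {g} {t} {d} eq (r , taylor) = r , λ h →
  trans (≡-sym (eq (t + h))) (trans (taylor h) (cong (λ x → x + h * d + h * h * r h) (eq t)))

derivative-* : ∀ {f g t d e} → HasDerivative f t d → HasDerivative g t e →
               HasDerivative (λ t → f t * g t) t (d * g t + f t * e)
derivative-* {f} {g} {t} {d} {e} (r , eqr) (q , eqq) =
  (λ h → f t * q h + d * e + h * d * q h + r h * (g t + h * e + h * h * q h)) ,
  λ h → trans (cong₂ _*_ (eqr h) (eqq h)) (lem (f t) (g t) d e h (r h) (q h))
  where
  lem : ∀ f g d e h r q → (f + h * d + h * h * r) * (g + h * e + h * h * q) ≡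
        f * g + h * (d * g + f * e) + h * h * (f * q + d * e + h * d * q + r * (g + h * e + h * h * q))
  lem = solve-∀

-- Characterising the derivative through its product with t + x avoids the exponent k - 1, and it is
-- this product that occurs after multiplication by `w`.
derivative-^ : ∀ x k t → Σ ℤ λ d → HasDerivative (λ t → (t + x) ^ k) t d × (t + x) * d ≡ + k * (t + x) ^ k
derivative-^ x zero    t = 0ℤ , ((λ _ → 0ℤ) , λ h → lem h) , lem′ (t + x)
  where
  lem : ∀ h → 1ℤ ≡ 1ℤ + h * 0ℤ + h * h * 0ℤ
  lem = solve-∀
  lem′ : ∀ y → y * 0ℤ ≡ 0ℤ
  lem′ = solve-∀
derivative-^ x (suc k) t with derivative-^ x k t
... | d , has , eq = 1ℤ * (t + x) ^ k + (t + x) * d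
                   , derivative-* {f = λ t → t + x} ((λ _ → 0ℤ) , λ h → lem t x h) has
                   , trans (cong (λ y → (t + x) * (1ℤ * (t + x) ^ k + y)) eq)
                           (trans (lem′ (t + x) ((t + x) ^ k) (+ k)) (cong (λ c → c * ((t + x) * (t + x) ^ k)) (≡-sym (ℤₚ.pos-+ 1 k))))
  where
  lem : ∀ t x h → t + h + x ≡ t + x + h * 1ℤ + h * h * 0ℤ
  lem = solve-∀
  lem′ : ∀ y z k → y * (1ℤ * z + k * z) ≡ (1ℤ + k) * (y * z)
  lem′ = solve-∀

charPolyAt-derivative : ∀ {n} (A : Matrix n) t → HasDerivative (charPolyAt A) t (detDeriv (charMatrix A t) Id)
charPolyAt-derivative A t with det-taylor (charMatrix A t) Id
... | r , taylor = r , λ h → trans (det-cong (entry h)) (taylor h)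
  where
  lem : ∀ t h i a → (t + h) * i - a ≡ t * i - a + h * i
  lem = solve-∀
  entry : ∀ h → charMatrix A (t + h) ≐ λ i j → charMatrix A t i j + h * Id i j
  entry h i j = trans (charMatrix-Id A (t + h) i j)
    (trans (lem t h (Id i j) (A i j)) (cong (λ x → x + h * Id i j) (≡-sym (charMatrix-Id A t i j))))

-- Annihilating polynomial of a symmetric matrix

charPolyAt-dominates : ∀ {n} (A C : Matrix n) → Eventually λ s → ∀ e →
                       charPolyAt A (at s) * e ≡ detDeriv (charMatrix A (at s)) C → e ≡ 0ℤ
charPolyAt-dominates {zero}  A C = 0 , λ s _ e eq → trans (≡-sym (ℤₚ.*-identityˡ e)) eq
charPolyAt-dominates {suc n} A C = 
  monic-dominates {p = λ s → charPolyAt A (at s)} (charPolyAt-monic A) (detDeriv-O A C)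

square-nonneg : ∀ x → 0ℤ ≤ x * x
square-nonneg (+ n)        = subst (0ℤ ≤_) (ℤₚ.pos-* n n) (ℤ.+≤+ z≤n)
square-nonneg ℤ.-[1+ n ] = ℤ.+≤+ z≤n

sum-nonneg : ∀ {n} {f : Fin n → ℤ} → (∀ i → 0ℤ ≤ f i) → 0ℤ ≤ sumFin f
sum-nonneg {zero}  f≥0 = ℤₚ.≤-refl
sum-nonneg {suc n} f≥0 = ℤₚ.+-mono-≤ (f≥0 zero) (sum-nonneg (f≥0 ∘ suc))

term≤sum : ∀ {n} {f : Fin n → ℤ} → (∀ i → 0ℤ ≤ f i) → ∀ i → f i ≤ sumFin f
term≤sum {f = f} f≥0 zero    = subst (_≤ sumFin f) (ℤₚ.+-identityʳ (f zero)) (ℤₚ.+-monoʳ-≤ (f zero) (sum-nonneg (f≥0 ∘ suc)))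
term≤sum {f = f} f≥0 (suc i) = subst (_≤ sumFin f) (ℤₚ.+-identityˡ (f (suc i))) (ℤₚ.+-mono-≤ (f≥0 zero) (term≤sum (f≥0 ∘ suc) i))

sum≤0⇒term≡0 : ∀ {n} {f : Fin n → ℤ} → (∀ i → 0ℤ ≤ f i) → sumFin f ≤ 0ℤ → ∀ i → f i ≡ 0ℤ
sum≤0⇒term≡0 f≥0 sum≤0 i = ℤₚ.≤-antisym (ℤₚ.≤-trans (term≤sum f≥0 i) sum≤0) (f≥0 i)

square≡0 : ∀ x → x * x ≡ 0ℤ → x ≡ 0ℤ
square≡0 x eq with ℤₚ.i*j≡0⇒i≡0∨j≡0 x eq
... | inj₁ p = p
... | inj₂ p = p

⊗-linearʳ : ∀ {n} (C : Matrix n) x y (E F : Matrix n) →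
            C ⊗ (λ i j → x * E i j + y * F i j) ≐ λ i j → x * (C ⊗ E) i j + y * (C ⊗ F) i j
⊗-linearʳ C x y E F i j = trans (sum-cong λ k → distrib (C i k) x (E k j) y (F k j))
                                (sum-linear x y (λ k → C i k * E k j) (λ k → C i k * F k j))
  where
  distrib : ∀ c x e y f → c * (x * e + y * f) ≡ x * (c * e) + y * (c * f)
  distrib = solve-∀

trace-⊗-linearʳ : ∀ {n} (C : Matrix n) x y (E F : Matrix n) →
                  trace (C ⊗ (λ i j → x * E i j + y * F i j)) ≡ x * trace (C ⊗ E) + y * trace (C ⊗ F)
trace-⊗-linearʳ C x y E F = trans (sum-cong λ i → ⊗-linearʳ C x y E F i i)
                                  (sum-linear x y (λ i → (C ⊗ E) i i) (λ i → (C ⊗ F) i i))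

trace-cong : ∀ {n} {M N : Matrix n} → M ≐ N → trace M ≡ trace N
trace-cong eq = sum-cong λ i → eq i i

trace-square≡0 : ∀ {n} (C : Matrix n) → Symmetric C → trace (C ⊗ C) ≡ 0ℤ → ∀ i j → C i j ≡ 0ℤ
trace-square≡0 C symC eq i j = square≡0 (C i j) (trans (cong (C i j *_) (symC i j))
  (sum≤0⇒term≡0 (nonneg i) (ℤₚ.≤-reflexive (row i)) j))
  where
  nonneg : ∀ i j → 0ℤ ≤ C i j * C j i
  nonneg i j = subst (λ x → 0ℤ ≤ C i j * x) (symC i j) (square-nonneg (C i j))
  row : ∀ i → (C ⊗ C) i i ≡ 0ℤ
  row = sum≤0⇒term≡0 {f = λ i → (C ⊗ C) i i} (λ i → sum-nonneg (nonneg i)) (ℤₚ.≤-reflexive eq)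

Null : ∀ {n} → Matrix n → Matrix n → Set
Null A C = Eventually λ s → detDeriv (charMatrix A (at s)) C ≡ 0ℤ

-- detDeriv (tI − A) C is the trace of C times the adjugate of tI − A, whose
-- coefficients in t span the same space as the powers of A.
Null-trace : ∀ {n} (A C : Matrix n) → Null A C → trace C ≡ 0ℤ
Null-trace A C null = ℤₚ.neg-injective
  (proj₂ ev (proj₁ ev) ℕₚ.≤-refl)
  where
  lem : ∀ t p c → p * - c ≡ t * 0ℤ - c * p
  lem = solve-∀
  -- Once D(C) = 0, the recursion leaves D(C A) = -tr(C) p, and D(C A) has smaller degree than p.
  ev : Eventually λ s → - trace C ≡ 0ℤ
  ev = eventually-zip (λ s dominates eq → dominates (- trace C)
         (trans (lem (at s) (charPolyAt A (at s)) (trace C))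
                (≡-sym (trans (detDeriv-⊗A A C (at s)) (cong (λ x → at s * x - trace C * charPolyAt A (at s)) eq)))))
       (charPolyAt-dominates A (C ⊗ A)) null

-- Iterated, this yields tr(C Aᵏ) = 0 for all powers of `A`.
Null-⊗ : ∀ {n} (A C : Matrix n) → Null A C → Null A (C ⊗ A)
Null-⊗ A C null@(S , eq) = S , λ s large →
  trans (detDeriv-⊗A A C (at s))
        (trans (cong₂ (λ x y → at s * x - y * charPolyAt A (at s)) (eq s large) (Null-trace A C null)) (lem (at s) (charPolyAt A (at s))))
  where
  lem : ∀ t p → t * 0ℤ - 0ℤ * p ≡ 0ℤ
  lem = solve-∀

module Powers {n} (A : Matrix n) where
  A² A³ A⁴ : Matrix n
  A² = A ⊗ A
  A³ = A² ⊗ A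
  A⁴ = A³ ⊗ A

  module _ (symA : Symmetric A) where
    A²-sym : Symmetric A²
    A²-sym = ⊗-transpose symA symA

    A³-sym : Symmetric A³
    A³-sym i j = trans (⊗-transpose A²-sym symA i j) (≡-sym (⊗-assoc A A A j i))

    A⁴-sym : Symmetric A⁴
    A⁴-sym i j = trans (⊗-transpose A³-sym symA i j)
      (trans (≡-sym (⊗-assoc A A² A j i)) (⊗-congˡ (λ i j → ≡-sym (⊗-assoc A A A i j)) A j i))

module Annihilation {n} (A : Matrix n) (symA : Symmetric A) (a b : ℕ) (c₀ c₁ c₂ : ℤ)
  (factor : ∀ t → charPolyAt A t ≡ (t - + 1) ^ a * (t + + 1) ^ b * (c₀ + c₁ * t + c₂ * t * t)) where
  open Powers A

  τ₀ τ₁ τ₂ τ₃ : ℤ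
  τ₀ = trace (Id {n})
  τ₁ = trace A
  τ₂ = trace A²
  τ₃ = trace A³

  -- (x² − 1)(c₀ + c₁ x + c₂ x²) evaluated at A.
  C₁ C₂ C₃ C : Matrix n
  C₁ i j = - c₁ * A i j + - c₀ * Id i j
  C₂ i j = (c₀ - c₂) * A² i j + 1ℤ * C₁ i j
  C₃ i j = c₁ * A³ i j + 1ℤ * C₂ i j
  C  i j = c₂ * A⁴ i j + 1ℤ * C₃ i j

  C-sym : Symmetric C
  C-sym i j = cong₂ (λ x y → c₂ * x + 1ℤ * y) (A⁴-sym symA i j)
             (cong₂ (λ x y → c₁ * x + 1ℤ * y) (A³-sym symA i j)
             (cong₂ (λ x y → (c₀ - c₂) * x + 1ℤ * y) (A²-sym symA i j)
             (cong₂ (λ x y → - c₁ * x + - c₀ * y) (symA i j) (Id-sym i j))))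

  -- The coefficients of the cubic D(C)/p. The terms with `a` and `b` come from w p′ = g p, those
  -- with traces from the recursion for D(Aᵏ).
  e₀ e₁ e₂ e₃ : ℤ
  e₀ = (+ a - + b) * c₀ - c₁ - c₂ * τ₃ - c₁ * τ₂ - (c₀ - c₂) * τ₁ + c₁ * τ₀
  e₁ = (+ a + + b) * c₀ + (+ a - + b) * c₁ - + 2 * c₂ - c₂ * τ₂ - c₁ * τ₁ - (c₀ - c₂) * τ₀
  e₂ = (+ a + + b) * c₁ + (+ a - + b) * c₂ + c₁ - c₂ * τ₁ - c₁ * τ₀
  e₃ = (+ a + + b) * c₂ + + 2 * c₂ - c₂ * τ₀

  e : ℤ → ℤ
  e t = e₀ + t * (e₁ + t * (e₂ + t * e₃))

  module _ (t : ℤ) where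
    private
      D : Matrix n → ℤ
      D = detDeriv (charMatrix A t)
      p p′ q g w : ℤ
      p  = charPolyAt A t
      p′ = D Id
      q  = c₀ + c₁ * t + c₂ * t * t
      g  = + a * (t + + 1) * q + + b * (t - + 1) * q + (t - + 1) * (t + + 1) * (c₁ + + 2 * c₂ * t)
      w  = (t - + 1) * (t + + 1) * q

    -- Multiplying a/(t - 1) + b/(t + 1) + q′/q by `w` clears all denominators and gives `g`. The
    -- computation never divides, so it also holds where p or q is zero.
    logDerivative : w * p′ ≡ p * g
    logDerivative with derivative-^ (- (+ 1)) a t | derivative-^ (+ 1) b t
    ... | d₁ , has₁ , eq₁ | d₂ , has₂ , eq₂ = trans (cong (w *_) p′≡) (trans
        (collect (t - + 1) (t + + 1) ((t - + 1) ^ a) ((t + + 1) ^ b) q d₁ d₂ q′)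
        (trans (cong₂ (λ x y → (t + + 1) * ((t + + 1) ^ b) * q * q * x + (t - + 1) * ((t - + 1) ^ a) * q * q * y
                               + (t - + 1) * (t + + 1) * ((t - + 1) ^ a) * ((t + + 1) ^ b) * q * q′) eq₁ eq₂)
        (trans (spread (t - + 1) (t + + 1) ((t - + 1) ^ a) ((t + + 1) ^ b) q (+ a) (+ b) q′)
               (cong (_* g) (≡-sym (factor t))))))
      where
      q′ = c₁ + + 2 * c₂ * t
      qe : ∀ c₀ c₁ c₂ t h → c₀ + c₁ * (t + h) + c₂ * (t + h) * (t + h) ≡
           c₀ + c₁ * t + c₂ * t * t + h * (c₁ + + 2 * c₂ * t) + h * h * c₂
      qe = solve-∀
      hasq : HasDerivative (λ t → c₀ + c₁ * t + c₂ * t * t) t q′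
      hasq = (λ _ → c₂) , qe c₀ c₁ c₂ t
      p′≡ : p′ ≡ (d₁ * (t + + 1) ^ b + (t - + 1) ^ a * d₂) * q + (t - + 1) ^ a * (t + + 1) ^ b * q′
      p′≡ = derivative-unique (charPolyAt-derivative A t)
              (derivative-resp (λ t → ≡-sym (factor t)) (derivative-* (derivative-* has₁ has₂) hasq))
      collect : ∀ x y X Y q d₁ d₂ q′ → x * y * q * ((d₁ * Y + X * d₂) * q + X * Y * q′) ≡
                y * Y * q * q * (x * d₁) + x * X * q * q * (y * d₂) + x * y * X * Y * q * q′
      collect = solve-∀
      spread : ∀ x y X Y q a b q′ → y * Y * q * q * (a * X) + x * X * q * q * (b * Y) + x * y * X * Y * q * q′ ≡
               X * Y * q * (a * y * q + b * x * q + x * y * q′)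
      spread = solve-∀

    detDeriv-C : D C ≡ p * e t
    detDeriv-C = begin
      D C
        ≡⟨ detDeriv-linear (charMatrix A t) c₂ 1ℤ A⁴ C₃ ⟩
      c₂ * D A⁴ + 1ℤ * D C₃
        ≡⟨ cong (λ x → c₂ * D A⁴ + 1ℤ * x) (detDeriv-linear (charMatrix A t) c₁ 1ℤ A³ C₂) ⟩
      c₂ * D A⁴ + 1ℤ * (c₁ * D A³ + 1ℤ * D C₂)
        ≡⟨ cong (λ x → c₂ * D A⁴ + 1ℤ * (c₁ * D A³ + 1ℤ * x)) (detDeriv-linear (charMatrix A t) (c₀ - c₂) 1ℤ A² C₁) ⟩
      c₂ * D A⁴ + 1ℤ * (c₁ * D A³ + 1ℤ * ((c₀ - c₂) * D A² + 1ℤ * D C₁))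
        ≡⟨ cong (λ x → c₂ * D A⁴ + 1ℤ * (c₁ * D A³ + 1ℤ * ((c₀ - c₂) * D A² + 1ℤ * x))) (detDeriv-linear (charMatrix A t) (- c₁) (- c₀) A Id) ⟩
      comb (D A⁴) (D A³) (D A²) (D A)
        -- One factor `A` is peeled off at a time, until only D(I) = p′ and traces remain.
        ≡⟨ cong (λ x → comb x (D A³) (D A²) (D A)) (detDeriv-⊗A A A³ t) ⟩
      comb (s₄ (D A³)) (D A³) (D A²) (D A)
        ≡⟨ cong (λ x → comb (s₄ x) x (D A²) (D A)) (detDeriv-⊗A A A² t) ⟩
      comb (s₄ (s₃ (D A²))) (s₃ (D A²)) (D A²) (D A)
        ≡⟨ cong (λ x → comb (s₄ (s₃ x)) (s₃ x) x (D A)) (detDeriv-⊗A A A t) ⟩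
      comb (s₄ (s₃ (s₂ (D A)))) (s₃ (s₂ (D A))) (s₂ (D A)) (D A)
        ≡⟨ cong (λ x → comb (s₄ (s₃ (s₂ x))) (s₃ (s₂ x)) (s₂ x) x) D-A ⟩
      comb (s₄ (s₃ (s₂ s₁))) (s₃ (s₂ s₁)) (s₂ s₁) s₁
        ≡⟨ ring₁ c₀ c₁ c₂ t p p′ τ₀ τ₁ τ₂ τ₃ ⟩
      w * p′ - p * (c₂ * (τ₀ * t * t * t + τ₁ * t * t + τ₂ * t + τ₃) + c₁ * (τ₀ * t * t + τ₁ * t + τ₂) + (c₀ - c₂) * (τ₀ * t + τ₁) - c₁ * τ₀)
        ≡⟨ cong (_- p * (c₂ * (τ₀ * t * t * t + τ₁ * t * t + τ₂ * t + τ₃) + c₁ * (τ₀ * t * t + τ₁ * t + τ₂) + (c₀ - c₂) * (τ₀ * t + τ₁) - c₁ * τ₀)) logDerivative ⟩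
      p * g - p * (c₂ * (τ₀ * t * t * t + τ₁ * t * t + τ₂ * t + τ₃) + c₁ * (τ₀ * t * t + τ₁ * t + τ₂) + (c₀ - c₂) * (τ₀ * t + τ₁) - c₁ * τ₀)
        ≡⟨ ring₂ (+ a) (+ b) c₀ c₁ c₂ t p τ₀ τ₁ τ₂ τ₃ ⟩
      p * e t ∎
      where
      open ≡-Reasoning
      comb : ℤ → ℤ → ℤ → ℤ → ℤ
      comb x₄ x₃ x₂ x₁ = c₂ * x₄ + 1ℤ * (c₁ * x₃ + 1ℤ * ((c₀ - c₂) * x₂ + 1ℤ * (- c₁ * x₁ + - c₀ * p′)))
      s₄ s₃ s₂ : ℤ → ℤ
      s₄ x = t * x - τ₃ * p
      s₃ x = t * x - τ₂ * p
      s₂ x = t * x - τ₁ * p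
      s₁ : ℤ
      s₁ = t * p′ - τ₀ * p
      D-A : D A ≡ s₁
      D-A = trans (≡-sym (detDeriv-cong (charMatrix A t) (⊗-identityˡ A))) (detDeriv-⊗A A Id t)
      ring₁ : ∀ c₀ c₁ c₂ t p p′ τ₀ τ₁ τ₂ τ₃ →
        c₂ * (t * (t * (t * (t * p′ - τ₀ * p) - τ₁ * p) - τ₂ * p) - τ₃ * p) + 1ℤ * (c₁ * (t * (t * (t * p′ - τ₀ * p) - τ₁ * p) - τ₂ * p)
          + 1ℤ * ((c₀ - c₂) * (t * (t * p′ - τ₀ * p) - τ₁ * p) + 1ℤ * (- c₁ * (t * p′ - τ₀ * p) + - c₀ * p′)))
        ≡ (t - + 1) * (t + + 1) * (c₀ + c₁ * t + c₂ * t * t) * p′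
          - p * (c₂ * (τ₀ * t * t * t + τ₁ * t * t + τ₂ * t + τ₃) + c₁ * (τ₀ * t * t + τ₁ * t + τ₂) + (c₀ - c₂) * (τ₀ * t + τ₁) - c₁ * τ₀)
      ring₁ = solve-∀
      ring₂ : ∀ a b c₀ c₁ c₂ t p τ₀ τ₁ τ₂ τ₃ →
        p * (a * (t + + 1) * (c₀ + c₁ * t + c₂ * t * t) + b * (t - + 1) * (c₀ + c₁ * t + c₂ * t * t) + (t - + 1) * (t + + 1) * (c₁ + + 2 * c₂ * t))
          - p * (c₂ * (τ₀ * t * t * t + τ₁ * t * t + τ₂ * t + τ₃) + c₁ * (τ₀ * t * t + τ₁ * t + τ₂) + (c₀ - c₂) * (τ₀ * t + τ₁) - c₁ * τ₀)
        ≡ p * (((a - b) * c₀ - c₁ - c₂ * τ₃ - c₁ * τ₂ - (c₀ - c₂) * τ₁ + c₁ * τ₀)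
          + t * (((a + b) * c₀ + (a - b) * c₁ - + 2 * c₂ - c₂ * τ₂ - c₁ * τ₁ - (c₀ - c₂) * τ₀)
          + t * (((a + b) * c₁ + (a - b) * c₂ + c₁ - c₂ * τ₁ - c₁ * τ₀)
          + t * ((a + b) * c₂ + + 2 * c₂ - c₂ * τ₀))))
      ring₂ = solve-∀

  e-vanishes : Eventually λ s → e (at s) ≡ 0ℤ
  e-vanishes with charPolyAt-dominates A C
  ... | S , dominates = S , λ s large → dominates s large (e (at s)) (≡-sym (detDeriv-C (at s)))

  -- The coefficients of odd powers of t are the ones that tie tr B to c₀ and c₂ in
  -- `trace-relation`.
  e₁≡0 : e₁ ≡ 0ℤ
  e₁≡0 = proj₁ (horner-vanish e₁ _ (proj₂ (horner-vanish e₀ _ e-vanishes)))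

  e₃≡0 : e₃ ≡ 0ℤ
  e₃≡0 = proj₁ (horner-vanish e₃ (λ _ → 0ℤ) (proj₁ h , λ s large →
      trans (cong (_+_ e₃) (ℤₚ.*-zeroʳ (at s))) (trans (ℤₚ.+-identityʳ e₃) (proj₂ h s large))))
    where
    h = proj₂ (horner-vanish e₂ (λ _ → e₃) (proj₂ (horner-vanish e₁ (λ s → e₂ + at s * e₃)
          (proj₂ (horner-vanish e₀ (λ s → e₁ + at s * (e₂ + at s * e₃)) e-vanishes)))))

  C-Null : Null A C
  C-Null = proj₁ e-vanishes , λ s large →
    trans (detDeriv-C (at s)) (trans (cong (charPolyAt A (at s) *_) (proj₂ e-vanishes s large)) (ℤₚ.*-zeroʳ (charPolyAt A (at s))))

  -- One factor `C` is written out as a polynomial in `A`, which leaves a combination of the numbers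
  -- tr(C Aᵏ) with k ≤ 4.
  trace-C² : trace (C ⊗ C) ≡ 0ℤ
  trace-C² = begin
    trace (C ⊗ C)
      ≡⟨ trace-⊗-linearʳ C c₂ 1ℤ A⁴ C₃ ⟩
    c₂ * trace (C ⊗ A⁴) + 1ℤ * trace (C ⊗ C₃)
      ≡⟨ cong₂ (λ x y → c₂ * x + 1ℤ * y) t₄ (trace-⊗-linearʳ C c₁ 1ℤ A³ C₂) ⟩
    c₂ * 0ℤ + 1ℤ * (c₁ * trace (C ⊗ A³) + 1ℤ * trace (C ⊗ C₂))
      ≡⟨ cong₂ (λ x y → c₂ * 0ℤ + 1ℤ * (c₁ * x + 1ℤ * y)) t₃ (trace-⊗-linearʳ C (c₀ - c₂) 1ℤ A² C₁) ⟩
    c₂ * 0ℤ + 1ℤ * (c₁ * 0ℤ + 1ℤ * ((c₀ - c₂) * trace (C ⊗ A²) + 1ℤ * trace (C ⊗ C₁)))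
      ≡⟨ cong₂ (λ x y → c₂ * 0ℤ + 1ℤ * (c₁ * 0ℤ + 1ℤ * ((c₀ - c₂) * x + 1ℤ * y))) t₂
           (trans (trace-⊗-linearʳ C (- c₁) (- c₀) A Id) (cong₂ (λ x y → - c₁ * x + - c₀ * y) t₁ t₀)) ⟩
    c₂ * 0ℤ + 1ℤ * (c₁ * 0ℤ + 1ℤ * ((c₀ - c₂) * 0ℤ + 1ℤ * (- c₁ * 0ℤ + - c₀ * 0ℤ)))
      ≡⟨ ring c₀ c₁ c₂ ⟩
    0ℤ ∎
    where
    open ≡-Reasoning
    ring : ∀ c₀ c₁ c₂ → c₂ * 0ℤ + 1ℤ * (c₁ * 0ℤ + 1ℤ * ((c₀ - c₂) * 0ℤ + 1ℤ * (- c₁ * 0ℤ + - c₀ * 0ℤ))) ≡ 0ℤ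
    ring = solve-∀
    N₁ = Null-⊗ A C C-Null
    N₂ = Null-⊗ A (C ⊗ A) N₁
    N₃ = Null-⊗ A (C ⊗ A ⊗ A) N₂
    N₄ = Null-⊗ A (C ⊗ A ⊗ A ⊗ A) N₃
    ≐₂ : C ⊗ A ⊗ A ≐ C ⊗ A²
    ≐₂ = ⊗-assoc C A A
    ≐₃ : C ⊗ A ⊗ A ⊗ A ≐ C ⊗ A³
    ≐₃ i j = trans (⊗-congˡ ≐₂ A i j) (⊗-assoc C A² A i j)
    ≐₄ : C ⊗ A ⊗ A ⊗ A ⊗ A ≐ C ⊗ A⁴
    ≐₄ i j = trans (⊗-congˡ ≐₃ A i j) (⊗-assoc C A³ A i j)
    t₀ : trace (C ⊗ Id) ≡ 0ℤ
    t₀ = trans (trace-cong (⊗-identityʳ C)) (Null-trace A C C-Null)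
    t₁ : trace (C ⊗ A) ≡ 0ℤ
    t₁ = Null-trace A (C ⊗ A) N₁
    t₂ : trace (C ⊗ A²) ≡ 0ℤ
    t₂ = trans (≡-sym (trace-cong ≐₂)) (Null-trace A (C ⊗ A ⊗ A) N₂)
    t₃ : trace (C ⊗ A³) ≡ 0ℤ
    t₃ = trans (≡-sym (trace-cong ≐₃)) (Null-trace A (C ⊗ A ⊗ A ⊗ A) N₃)
    t₄ : trace (C ⊗ A⁴) ≡ 0ℤ
    t₄ = trans (≡-sym (trace-cong ≐₄)) (Null-trace A (C ⊗ A ⊗ A ⊗ A ⊗ A) N₄)

  C≡0 : ∀ i j → C i j ≡ 0ℤ
  C≡0 = trace-square≡0 C C-sym trace-C²

  -- If q were zero, so would be the characteristic polynomial; but it is monic. Domination refutes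
  -- this with direction 0 and cofactor 1.
  q-nonzero : ¬ (c₀ ≡ 0ℤ × c₁ ≡ 0ℤ × c₂ ≡ 0ℤ)
  q-nonzero (refl , refl , refl) with charPolyAt-dominates A (λ _ _ → 0ℤ)
  ... | S , dominates = contradiction (dominates S ℕₚ.≤-refl 1ℤ (trans p≡0 (≡-sym D≡0))) λ ()
    where
    D≡0 : detDeriv (charMatrix A (at S)) (λ _ _ → 0ℤ) ≡ 0ℤ
    D≡0 = sum-zero λ i → det-zero-row (charMatrix A (at S)) i λ _ → refl
    lem : ∀ x t → x * (0ℤ + 0ℤ * t + 0ℤ * t * t) * 1ℤ ≡ 0ℤ
    lem = solve-∀
    p≡0 : charPolyAt A (at S) * 1ℤ ≡ 0ℤ
    p≡0 = trans (cong (_* 1ℤ) (factor (at S))) (lem ((at S - + 1) ^ a * (at S + + 1) ^ b) (at S))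

-- Bipartite matrices

*-nonneg : ∀ {x y} → 0ℤ ≤ x → 0ℤ ≤ y → 0ℤ ≤ x * y
*-nonneg {+ m} {+ n} _ _ = subst (0ℤ ≤_) (ℤₚ.pos-* m n) (ℤ.+≤+ z≤n)

cancel-zero : ∀ {x y} → x ≢ 0ℤ → x * y ≡ 0ℤ → y ≡ 0ℤ
cancel-zero {x} x≢0 eq with ℤₚ.i*j≡0⇒i≡0∨j≡0 x eq
... | inj₁ x≡0 = contradiction x≡0 x≢0
... | inj₂ y≡0 = y≡0

module Square {n} (A : Matrix n) (symA : Symmetric A) where
  open Powers A public

  B : Matrix n
  B i j = A² i j - Id i j

  B-sym : Symmetric B
  B-sym i j = cong₂ _-_ (A²-sym symA i j) (Id-sym i j)

  B-off : ∀ {i j} → i ≢ j → B i j ≡ A² i j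
  B-off {i} {j} i≢j = trans (cong (_-_ (A² i j)) (Id-off i≢j)) (ℤₚ.+-identityʳ (A² i j))

  A²-rows : ∀ i j → A² i j ≡ sumFin (λ k → A i k * A j k)
  A²-rows i j = sum-cong λ k → cong (A i k *_) (symA k j)

  B²-rows : ∀ i j → (B ⊗ B) i j ≡ sumFin (λ k → B i k * B j k)
  B²-rows i j = sum-cong λ k → cong (B i k *_) (B-sym k j)

  B² : ∀ i j → (B ⊗ B) i j ≡ A⁴ i j - A² i j - (A² i j - Id i j)
  B² i j = begin
    (B ⊗ B) i j
      ≡⟨ sum-cong (λ k → split (B i k) (A² k j) (Id k j)) ⟩
    sumFin (λ k → 1ℤ * (B i k * A² k j) + -1ℤ * (B i k * Id k j))
      ≡⟨ sum-linear 1ℤ -1ℤ (λ k → B i k * A² k j) (λ k → B i k * Id k j) ⟩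
    1ℤ * (B ⊗ A²) i j + -1ℤ * (B ⊗ Id) i j
      ≡⟨ cong₂ (λ x y → 1ℤ * x + -1ℤ * y) BA² (⊗-identityʳ B i j) ⟩
    1ℤ * (1ℤ * A⁴ i j + -1ℤ * A² i j) + -1ℤ * (A² i j - Id i j)
      ≡⟨ tidy (A⁴ i j) (A² i j) (Id i j) ⟩
    A⁴ i j - A² i j - (A² i j - Id i j) ∎
    where
    open ≡-Reasoning
    split : ∀ b x y → b * (x - y) ≡ 1ℤ * (b * x) + -1ℤ * (b * y)
    split = solve-∀
    split′ : ∀ x y z → (x - y) * z ≡ 1ℤ * (x * z) + -1ℤ * (y * z)
    split′ = solve-∀
    tidy : ∀ x y z → 1ℤ * (1ℤ * x + -1ℤ * y) + -1ℤ * (y - z) ≡ x - y - (y - z)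
    tidy = solve-∀
    BA² : (B ⊗ A²) i j ≡ 1ℤ * A⁴ i j + -1ℤ * A² i j
    BA² = begin
      (B ⊗ A²) i j
        ≡⟨ sum-cong (λ k → split′ (A² i k) (Id i k) (A² k j)) ⟩
      sumFin (λ k → 1ℤ * (A² i k * A² k j) + -1ℤ * (Id i k * A² k j))
        ≡⟨ sum-linear 1ℤ -1ℤ (λ k → A² i k * A² k j) (λ k → Id i k * A² k j) ⟩
      1ℤ * (A² ⊗ A²) i j + -1ℤ * (Id ⊗ A²) i j
        ≡⟨ cong₂ (λ x y → 1ℤ * x + -1ℤ * y) (≡-sym (⊗-assoc A² A A i j)) (⊗-identityˡ A² i j) ⟩
      1ℤ * A⁴ i j + -1ℤ * A² i j ∎

  trace-B : trace B ≡ trace A² - trace (Id {n})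
  trace-B = begin
    trace B                                          ≡⟨ sum-cong (λ i → split (A² i i) (Id i i)) ⟩
    sumFin (λ i → 1ℤ * A² i i + -1ℤ * Id i i)        ≡⟨ sum-linear 1ℤ -1ℤ (λ i → A² i i) (λ i → Id i i) ⟩
    1ℤ * trace A² + -1ℤ * trace (Id {n})                   ≡⟨ split (trace A²) (trace (Id {n})) ⟨
    trace A² - trace (Id {n}) ∎
    where
    open ≡-Reasoning
    split : ∀ x y → x - y ≡ 1ℤ * x + -1ℤ * y
    split = solve-∀

module Coloured {n} (A : Matrix n) (symA : Symmetric A) (c : Fin n → Bool)
                (off : ∀ i j → c i ≡ c j → A i j ≡ 0ℤ) where
  open Square A symA

  -- Block diagonal and block off-diagonal matrices for the colouring. Multiplication by `A`
  -- exchanges the two kinds, so w(A) = 0 splits into two equations.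
  Even Odd : Matrix n → Set
  Even M = ∀ i j → c i ≢ c j → M i j ≡ 0ℤ
  Odd  M = ∀ i j → c i ≡ c j → M i j ≡ 0ℤ

  bool-≢ : ∀ {x y z : Bool} → x ≢ y → x ≢ z → y ≡ z
  bool-≢ x≢y x≢z = trans (Boolₚ.¬-not (x≢y ∘ ≡-sym)) (≡-sym (Boolₚ.¬-not (x≢z ∘ ≡-sym)))

  zeroˡ : ∀ {x} y → x ≡ 0ℤ → x * y ≡ 0ℤ
  zeroˡ y refl = ℤₚ.*-zeroˡ y

  zeroʳ : ∀ x {y} → y ≡ 0ℤ → x * y ≡ 0ℤ
  zeroʳ x refl = ℤₚ.*-zeroʳ x

  odd-⊗ : ∀ {M} → Odd M → Even (M ⊗ A)
  odd-⊗ {M} odd i j ci≢cj = sum-zero λ k → term k (c i Boolₚ.≟ c k)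
    where
    term : ∀ k → Dec (c i ≡ c k) → M i k * A k j ≡ 0ℤ
    term k (yes ci≡ck) = zeroˡ (A k j) (odd i k ci≡ck)
    term k (no  ci≢ck) = zeroʳ (M i k) (off k j (bool-≢ ci≢ck ci≢cj))

  even-⊗ : ∀ {M} → Even M → Odd (M ⊗ A)
  even-⊗ {M} even i j ci≡cj = sum-zero λ k → term k (c i Boolₚ.≟ c k)
    where
    term : ∀ k → Dec (c i ≡ c k) → M i k * A k j ≡ 0ℤ
    term k (yes ci≡ck) = zeroʳ (M i k) (off k j (trans (≡-sym ci≡ck) ci≡cj))
    term k (no  ci≢ck) = zeroˡ (A k j) (even i k ci≢ck)

  A²-even : Even A²
  A²-even = odd-⊗ off

  A³-odd : Odd A³
  A³-odd = even-⊗ A²-even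

  A⁴-even : Even A⁴
  A⁴-even = odd-⊗ A³-odd

  Id-even : Even Id
  Id-even i j ci≢cj = Id-off (ci≢cj ∘ cong c)

  B-even : Even B
  B-even i j ci≢cj = cong₂ _-_ (A²-even i j ci≢cj) (Id-even i j ci≢cj)

  module Quadratic (a b : ℕ) (c₀ c₁ c₂ : ℤ)
    (factor : ∀ t → charPolyAt A t ≡ (t - + 1) ^ a * (t + + 1) ^ b * (c₀ + c₁ * t + c₂ * t * t))
    (diag≥0 : ∀ i → 0ℤ ≤ B i i) where
    open Annihilation A symA a b c₀ c₁ c₂ factor using (C≡0; e₁≡0; e₃≡0; q-nonzero; τ₀; τ₁; τ₂)

    B≡0⇒ : (∀ i j → B i j ≡ 0ℤ) → ∀ i j → + 2 * (B ⊗ B) i j ≡ trace B * B i j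
    B≡0⇒ B≡0 i j = trans (zeroʳ (+ 2) (sum-zero λ k → zeroˡ (B k j) (B≡0 i k))) (≡-sym (zeroʳ (trace B) (B≡0 i j)))

    -- The even part of w(A) is c₂A⁴ + (c₀ - c₂)A² - c₀I = B (c₂B + (c₀ + c₂)I).
    evenPart : ∀ i j → c₂ * (B ⊗ B) i j ≡ - (c₀ + c₂) * B i j
    evenPart i j = trans (cong (c₂ *_) (B² i j)) (go (c i Boolₚ.≟ c j))
      where
      ring : ∀ c₀ c₁ c₂ x₄ x₂ d → c₂ * (x₄ - x₂ - (x₂ - d)) ≡
             (c₂ * x₄ + 1ℤ * (c₁ * 0ℤ + 1ℤ * ((c₀ - c₂) * x₂ + 1ℤ * (- c₁ * 0ℤ + - c₀ * d)))) + - (c₀ + c₂) * (x₂ - d)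
      ring = solve-∀
      vanish : ∀ c₀ c₂ → c₂ * (0ℤ - 0ℤ - (0ℤ - 0ℤ)) ≡ - (c₀ + c₂) * (0ℤ - 0ℤ)
      vanish = solve-∀
      C≡0′ : c i ≡ c j → c₂ * A⁴ i j + 1ℤ * (c₁ * 0ℤ + 1ℤ * ((c₀ - c₂) * A² i j + 1ℤ * (- c₁ * 0ℤ + - c₀ * Id i j))) ≡ 0ℤ
      C≡0′ eq = trans (cong₂ (λ x y → c₂ * A⁴ i j + 1ℤ * (c₁ * x + 1ℤ * ((c₀ - c₂) * A² i j + 1ℤ * (- c₁ * y + - c₀ * Id i j))))
                             (≡-sym (A³-odd i j eq)) (≡-sym (off i j eq))) (C≡0 i j)
      go : Dec (c i ≡ c j) → c₂ * (A⁴ i j - A² i j - (A² i j - Id i j)) ≡ - (c₀ + c₂) * (A² i j - Id i j)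
      go (yes eq) = trans (ring c₀ c₁ c₂ (A⁴ i j) (A² i j) (Id i j))
                          (trans (cong (_+ - (c₀ + c₂) * (A² i j - Id i j)) (C≡0′ eq)) (ℤₚ.+-identityˡ _))
      go (no neq) rewrite A⁴-even i j neq | A²-even i j neq | Id-even i j neq = vanish c₀ c₂

    -- The odd part of w(A) is c₁(A³ - A).
    oddPart : c₁ ≢ 0ℤ → A³ ≐ A
    oddPart c₁≢0 i j = go (c i Boolₚ.≟ c j)
      where
      ring : ∀ c₀ c₁ c₂ x₃ x → c₁ * (x₃ - x) ≡
             c₂ * 0ℤ + 1ℤ * (c₁ * x₃ + 1ℤ * ((c₀ - c₂) * 0ℤ + 1ℤ * (- c₁ * x + - c₀ * 0ℤ)))
      ring = solve-∀
      C≡0′ : c i ≢ c j → c₂ * 0ℤ + 1ℤ * (c₁ * A³ i j + 1ℤ * ((c₀ - c₂) * 0ℤ + 1ℤ * (- c₁ * A i j + - c₀ * 0ℤ))) ≡ 0ℤ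
      C≡0′ neq = trans (cong₂ (λ x y → c₂ * x + 1ℤ * (c₁ * A³ i j + 1ℤ * y))
                              (≡-sym (A⁴-even i j neq))
                              (cong₂ (λ x y → (c₀ - c₂) * x + 1ℤ * (- c₁ * A i j + - c₀ * y))
                                     (≡-sym (A²-even i j neq)) (≡-sym (Id-even i j neq))))
                       (C≡0 i j)
      go : Dec (c i ≡ c j) → A³ i j ≡ A i j
      go (yes eq) = trans (A³-odd i j eq) (≡-sym (off i j eq))
      go (no neq) = ℤₚ.i-j≡0⇒i≡j (A³ i j) (A i j)
        (cancel-zero c₁≢0 (trans (ring c₀ c₁ c₂ (A³ i j) (A i j)) (C≡0′ neq)))

    -- Here A² is an idempotent, with diagonal at least 1 and integral entries.
    A³≐A⇒B≡0 : A³ ≐ A → ∀ i j → B i j ≡ 0ℤ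
    A³≐A⇒B≡0 A³≐A i j = square≡0 (B i j) (sum≤0⇒term≡0 (λ k → square-nonneg (B i k)) row≤0 j)
      where
      negate : ∀ x d → x - x - (x - d) ≡ - (x - d)
      negate = solve-∀
      row : sumFin (λ k → B i k * B i k) ≡ - B i i
      row = trans (≡-sym (B²-rows i i)) (trans (B² i i)
              (trans (cong (λ x → x - A² i i - B i i) (⊗-congˡ A³≐A A i i)) (negate (A² i i) (Id i i))))
      row≤0 : sumFin (λ k → B i k * B i k) ≤ 0ℤ
      row≤0 = subst (_≤ 0ℤ) (≡-sym row) (ℤₚ.neg-mono-≤ (diag≥0 i))

    -- The combination c₀e₃ - c₂e₁ eliminates a + b, while c₁ = 0 removes a - b; what is left of the
    -- traces is τ₂ - τ₀ = tr B. With θ² = -c₀/c₂ this reads tr B = 2(θ² - 1).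
    trace-relation : c₁ ≡ 0ℤ → c₂ ≢ 0ℤ → c₂ * trace B + + 2 * (c₀ + c₂) ≡ 0ℤ
    trace-relation refl c₂≢0 = cancel-zero c₂≢0 (begin
      c₂ * (c₂ * trace B + + 2 * (c₀ + c₂))
        ≡⟨ cong (λ x → c₂ * (c₂ * x + + 2 * (c₀ + c₂))) trace-B ⟩
      c₂ * (c₂ * (τ₂ - τ₀) + + 2 * (c₀ + c₂))
        ≡⟨ ring (+ a) (+ b) c₀ c₂ τ₀ τ₁ τ₂ ⟩
      c₀ * ((+ a + + b) * c₂ + + 2 * c₂ - c₂ * τ₀)
        - c₂ * ((+ a + + b) * c₀ + (+ a - + b) * 0ℤ - + 2 * c₂ - c₂ * τ₂ - 0ℤ * τ₁ - (c₀ - c₂) * τ₀)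
        ≡⟨ cong₂ (λ x y → c₀ * x - c₂ * y) e₃≡0 e₁≡0 ⟩
      c₀ * 0ℤ - c₂ * 0ℤ
        ≡⟨ vanish c₀ c₂ ⟩
      0ℤ ∎)
      where
      open ≡-Reasoning
      ring : ∀ a b c₀ c₂ τ₀ τ₁ τ₂ → c₂ * (c₂ * (τ₂ - τ₀) + + 2 * (c₀ + c₂)) ≡
             c₀ * ((a + b) * c₂ + + 2 * c₂ - c₂ * τ₀)
             - c₂ * ((a + b) * c₀ + (a - b) * 0ℤ - + 2 * c₂ - c₂ * τ₂ - 0ℤ * τ₁ - (c₀ - c₂) * τ₀)
      ring = solve-∀
      vanish : ∀ x y → x * 0ℤ - y * 0ℤ ≡ 0ℤ
      vanish = solve-∀

    -- If c₁ ≠ 0, or if q is a nonzero constant, then B = 0 and both sides vanish. In the remaining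
    -- case `evenPart` and `trace-relation` combine after multiplication by c₂.
    quadratic : ∀ i j → + 2 * (B ⊗ B) i j ≡ trace B * B i j
    quadratic with c₁ ℤₚ.≟ 0ℤ
    ... | no  c₁≢0 = B≡0⇒ (A³≐A⇒B≡0 (oddPart c₁≢0))
    ... | yes c₁≡0 with c₂ ℤₚ.≟ 0ℤ
    ...   | yes c₂≡0 = B≡0⇒ λ i j → cancel-zero -c₀-c₂≢0 (trans (≡-sym (evenPart i j)) (zeroˡ ((B ⊗ B) i j) c₂≡0))
      where
      lem : ∀ x → - (- (x + 0ℤ)) ≡ x
      lem = solve-∀
      -c₀-c₂≢0 : - (c₀ + c₂) ≢ 0ℤ
      -c₀-c₂≢0 eq = q-nonzero (trans (≡-sym (lem c₀)) (cong -_ (trans (cong (λ x → - (c₀ + x)) (≡-sym c₂≡0)) eq)) , c₁≡0 , c₂≡0)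
    ...   | no  c₂≢0 = λ i j → ℤₚ.i-j≡0⇒i≡j _ _ (cancel-zero c₂≢0 (begin
        c₂ * (+ 2 * (B ⊗ B) i j - trace B * B i j)
          ≡⟨ ring₁ c₂ ((B ⊗ B) i j) (trace B) (B i j) ⟩
        + 2 * (c₂ * (B ⊗ B) i j) - c₂ * trace B * B i j
          ≡⟨ cong (λ x → + 2 * x - c₂ * trace B * B i j) (evenPart i j) ⟩
        + 2 * (- (c₀ + c₂) * B i j) - c₂ * trace B * B i j
          ≡⟨ ring₂ c₀ c₂ (trace B) (B i j) ⟩
        - (c₂ * trace B + + 2 * (c₀ + c₂)) * B i j
          ≡⟨ zeroˡ (B i j) (cong -_ (trace-relation c₁≡0 c₂≢0)) ⟩
        0ℤ ∎))
      where
      open ≡-Reasoning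
      ring₁ : ∀ c x t b → c * (+ 2 * x - t * b) ≡ + 2 * (c * x) - c * t * b
      ring₁ = solve-∀
      ring₂ : ∀ c₀ c₂ t b → + 2 * (- (c₀ + c₂) * b) - c₂ * t * b ≡ - (c₂ * t + + 2 * (c₀ + c₂)) * b
      ring₂ = solve-∀

-- Rank one on the smaller colour class

indicator : Bool → ℤ
indicator true  = 1ℤ
indicator false = 0ℤ

module RankOne {n} (B : Matrix n) (B-sym : Symmetric B) (quadratic : ∀ i j → + 2 * (B ⊗ B) i j ≡ trace B * B i j)
  (trace≥0 : 0ℤ ≤ trace B) (c : Fin n → Bool) (even : ∀ i j → c i ≢ c j → B i j ≡ 0ℤ)
  (small : + 2 * sumFin (λ i → indicator (c i) * B i i) ≤ trace B) where

  private
    T = trace B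
    T₁ = sumFin (λ i → indicator (c i) * B i i)
    u : Fin n → ℤ
    u i = indicator (c i)

  rows : ∀ i j → + 2 * sumFin (λ k → B i k * B j k) ≡ T * B i j
  rows i j = trans (cong (+ 2 *_) (sum-cong λ k → cong (B i k *_) (B-sym j k))) (quadratic i j)

  -- The squared length of the vector that measures how far rows i and j of `B` are from being
  -- proportional.
  defect : Fin n → Fin n → ℤ
  defect i j = sumFin λ k → (B j j * B i k - B i j * B j k) * (B j j * B i k - B i j * B j k)

  defect≥0 : ∀ i j → 0ℤ ≤ defect i j
  defect≥0 i j = sum-nonneg λ k → square-nonneg (B j j * B i k - B i j * B j k)

  -- By `rows`, twice an inner product of rows of `B` is T times an entry of `B`, so the squared
  -- length collapses to a principal 2 × 2 minor.
  defect-minor : ∀ i j → + 2 * defect i j ≡ T * B j j * (B j j * B i i - B i j * B i j)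
  defect-minor i j = begin
    + 2 * defect i j
      ≡⟨ cong (+ 2 *_) (sum-cong λ k → expand x y (B i k) (B j k)) ⟩
    + 2 * sumFin (λ k → x * x * (B i k * B i k) + 1ℤ * (- (+ 2 * x * y) * (B i k * B j k) + y * y * (B j k * B j k)))
      ≡⟨ cong (+ 2 *_) (sum-linear (x * x) 1ℤ (λ k → B i k * B i k) (λ k → - (+ 2 * x * y) * (B i k * B j k) + y * y * (B j k * B j k))) ⟩
    + 2 * (x * x * ii + 1ℤ * sumFin (λ k → - (+ 2 * x * y) * (B i k * B j k) + y * y * (B j k * B j k)))
      ≡⟨ cong (λ z → + 2 * (x * x * ii + 1ℤ * z)) (sum-linear (- (+ 2 * x * y)) (y * y) (λ k → B i k * B j k) (λ k → B j k * B j k)) ⟩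
    + 2 * (x * x * ii + 1ℤ * (- (+ 2 * x * y) * ij + y * y * jj))
      ≡⟨ distribute x y ii ij jj ⟩
    x * x * (+ 2 * ii) - + 2 * x * y * (+ 2 * ij) + y * y * (+ 2 * jj)
      ≡⟨ cong₂ (λ p q → x * x * p - + 2 * x * y * q + y * y * (+ 2 * jj)) (rows i i) (rows i j) ⟩
    x * x * (T * B i i) - + 2 * x * y * (T * y) + y * y * (+ 2 * jj)
      ≡⟨ cong (λ p → x * x * (T * B i i) - + 2 * x * y * (T * y) + y * y * p) (rows j j) ⟩
    x * x * (T * B i i) - + 2 * x * y * (T * y) + y * y * (T * x)
      ≡⟨ collect x y T (B i i) ⟩
    T * x * (x * B i i - y * y) ∎
    where
    open ≡-Reasoning
    x = B j j
    y = B i j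
    ii = sumFin (λ k → B i k * B i k)
    ij = sumFin (λ k → B i k * B j k)
    jj = sumFin (λ k → B j k * B j k)
    expand : ∀ x y p q → (x * p - y * q) * (x * p - y * q) ≡ x * x * (p * p) + 1ℤ * (- (+ 2 * x * y) * (p * q) + y * y * (q * q))
    expand = solve-∀
    distribute : ∀ x y p q r → + 2 * (x * x * p + 1ℤ * (- (+ 2 * x * y) * q + y * y * r)) ≡
                 x * x * (+ 2 * p) - + 2 * x * y * (+ 2 * q) + y * y * (+ 2 * r)
    distribute = solve-∀
    collect : ∀ x y t b → x * x * (t * b) - + 2 * x * y * (t * y) + y * y * (t * x) ≡ t * x * (x * b - y * y)
    collect = solve-∀

  column : ∀ j → c j ≡ true → + 2 * sumFin (λ i → u i * (B i j * B i j)) ≡ T * B j j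
  column j cj = trans (cong (+ 2 *_) (sum-cong term)) (rows j j)
    where
    term : ∀ i → u i * (B i j * B i j) ≡ B j i * B j i
    term i with c i in ci
    ... | true  = trans (ℤₚ.*-identityˡ _) (cong₂ _*_ (B-sym i j) (B-sym i j))
    ... | false = ≡-sym (cong₂ _*_ z z)
      where
      z : B j i ≡ 0ℤ
      z = even j i λ eq → contradiction (trans (≡-sym cj) (trans eq ci)) λ ()

  -- Over the class of `j`, the first halves of the minors add up to B j j · T₁ and, by `column`,
  -- the squares to half of T · B j j. The left side is a sum of squares, and `small` makes the
  -- right side at most 0.
  total : ∀ j → c j ≡ true → + 4 * sumFin (λ i → u i * defect i j) ≡ T * (B j j * B j j) * (+ 2 * T₁ - T)
  total j cj = begin
    + 4 * sumFin (λ i → u i * defect i j)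
      ≡⟨ four (sumFin (λ i → u i * defect i j)) ⟩
    + 2 * (+ 2 * sumFin (λ i → u i * defect i j))
      ≡⟨ cong (+ 2 *_) (≡-sym (sum-*ˡ (+ 2) (λ i → u i * defect i j))) ⟩
    + 2 * sumFin (λ i → + 2 * (u i * defect i j))
      ≡⟨ cong (+ 2 *_) (sum-cong λ i → trans (exchange (u i) (defect i j))
           (trans (cong (u i *_) (defect-minor i j)) (expand (u i) T x (B i i) (B i j)))) ⟩
    + 2 * sumFin (λ i → T * x * x * (u i * B i i) + - (T * x) * (u i * (B i j * B i j)))
      ≡⟨ cong (+ 2 *_) (sum-linear (T * x * x) (- (T * x)) (λ i → u i * B i i) (λ i → u i * (B i j * B i j))) ⟩
    + 2 * (T * x * x * T₁ + - (T * x) * sumFin (λ i → u i * (B i j * B i j)))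
      ≡⟨ distribute T x T₁ _ ⟩
    + 2 * T * x * x * T₁ - T * x * (+ 2 * sumFin (λ i → u i * (B i j * B i j)))
      ≡⟨ cong (λ z → + 2 * T * x * x * T₁ - T * x * z) (column j cj) ⟩
    + 2 * T * x * x * T₁ - T * x * (T * x)
      ≡⟨ collect T x T₁ ⟩
    T * (x * x) * (+ 2 * T₁ - T) ∎
    where
    open ≡-Reasoning
    x = B j j
    four : ∀ z → + 4 * z ≡ + 2 * (+ 2 * z)
    four = solve-∀
    exchange : ∀ u d → + 2 * (u * d) ≡ u * (+ 2 * d)
    exchange = solve-∀
    expand : ∀ u t x b y → u * (t * x * (x * b - y * y)) ≡ t * x * x * (u * b) + - (t * x) * (u * (y * y))
    expand = solve-∀
    distribute : ∀ t x s z → + 2 * (t * x * x * s + - (t * x) * z) ≡ + 2 * t * x * x * s - t * x * (+ 2 * z)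
    distribute = solve-∀
    collect : ∀ t x s → + 2 * t * x * x * s - t * x * (t * x) ≡ t * (x * x) * (+ 2 * s - t)
    collect = solve-∀

  rankOne : ∀ i j k → c i ≡ true → c j ≡ true → B j j * B i k ≡ B i j * B j k
  rankOne i j k ci cj = ℤₚ.i-j≡0⇒i≡j _ _ (square≡0 _
    (sum≤0⇒term≡0 (λ k → square-nonneg (B j j * B i k - B i j * B j k)) (ℤₚ.≤-reflexive defect≡0) k))
    where
    indicator*≥0 : ∀ b {x} → 0ℤ ≤ x → 0ℤ ≤ indicator b * x
    indicator*≥0 true  {x} x≥0 = subst (0ℤ ≤_) (≡-sym (ℤₚ.*-identityˡ x)) x≥0
    indicator*≥0 false {x} x≥0 = ℤₚ.≤-refl
    4S≤0 : + 4 * sumFin (λ i → u i * defect i j) ≤ + 4 * 0ℤ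
    4S≤0 = subst (_≤ 0ℤ) (≡-sym (total j cj)) (subst (_≤ 0ℤ) (flip (T * (B j j * B j j)) (+ 2 * T₁) T)
      (ℤₚ.neg-mono-≤ (*-nonneg (*-nonneg trace≥0 (square-nonneg (B j j))) (ℤₚ.i≤j⇒0≤j-i small))))
      where
      flip : ∀ p x y → - (p * (y - x)) ≡ p * (x - y)
      flip = solve-∀
    S≤0 : sumFin (λ i → u i * defect i j) ≤ 0ℤ
    S≤0 = ℤₚ.*-cancelˡ-≤-pos _ 0ℤ (+ 4) 4S≤0
    defect≡0 : defect i j ≡ 0ℤ
    defect≡0 = trans (≡-sym (trans (cong (λ b → indicator b * defect i j) ci) (ℤₚ.*-identityˡ (defect i j))))
                     (sum≤0⇒term≡0 (λ i → indicator*≥0 (c i) (defect≥0 i j)) S≤0 i)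

data Ternary : ℤ → Set where
  zer : Ternary 0ℤ
  pos : Ternary 1ℤ
  neg : Ternary -1ℤ

ternary-diff : ∀ {x y} → Ternary x → Ternary y → 0ℤ ≤ x * x - x * y
ternary-diff zer _   = ℤ.+≤+ z≤n
ternary-diff pos zer = ℤ.+≤+ z≤n
ternary-diff pos pos = ℤ.+≤+ z≤n
ternary-diff pos neg = ℤ.+≤+ z≤n
ternary-diff neg zer = ℤ.+≤+ z≤n
ternary-diff neg pos = ℤ.+≤+ z≤n
ternary-diff neg neg = ℤ.+≤+ z≤n

ternary-neg : ∀ {x} → Ternary x → Ternary (- x)
ternary-neg zer = zer
ternary-neg pos = neg
ternary-neg neg = pos

data Unit± : ℤ → Set where
  +1# : Unit± 1ℤ
  -1# : Unit± -1ℤ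

unit-square : ∀ {x} → Unit± x → x * x ≡ 1ℤ
unit-square +1# = refl
unit-square -1# = refl

unit-* : ∀ {x y} → Unit± x → Unit± y → Unit± (x * y)
unit-* +1# +1# = +1#
unit-* +1# -1# = -1#
unit-* -1# +1# = -1#
unit-* -1# -1# = +1#

ternary-unit : ∀ {x} → Ternary x → x ≢ 0ℤ → Unit± x
ternary-unit zer x≢0 = contradiction refl x≢0
ternary-unit pos x≢0 = +1#
ternary-unit neg x≢0 = -1#

-- The value 1 at 0 is a default that keeps every `sgn x` a unit; `sgn-product` only meets nonzero
-- arguments.
sgn : ℤ → ℤ
sgn (+ _)        = 1ℤ
sgn (ℤ.-[1+ _ ]) = -1ℤ

sgn-unit : ∀ x → Unit± (sgn x)
sgn-unit (+ _)        = +1#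
sgn-unit (ℤ.-[1+ _ ]) = -1#

sgn-product : ∀ {ε} → Unit± ε → ∀ x y → 1ℤ ≤ ε * (x * y) → sgn x * sgn y ≡ ε
sgn-product +1# (+ _)            (+ _)            _ = refl
sgn-product +1# (ℤ.-[1+ _ ])     (ℤ.-[1+ _ ])     _ = refl
sgn-product +1# (+ zero)         (ℤ.-[1+ _ ])     (ℤ.+≤+ ())
sgn-product +1# (+ suc _)        (ℤ.-[1+ _ ])     ()
sgn-product +1# (ℤ.-[1+ m ])     (+ zero)         le rewrite ℕₚ.*-zeroʳ m with le
... | ℤ.+≤+ ()
sgn-product +1# (ℤ.-[1+ _ ])     (+ suc _)        ()
sgn-product -1# (+ zero)         (+ _)            (ℤ.+≤+ ())
sgn-product -1# (+ suc m)        (+ zero)         le rewrite ℕₚ.*-zeroʳ m with le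
... | ℤ.+≤+ ()
sgn-product -1# (+ suc _)        (+ suc _)        ()
sgn-product -1# (+ _)            (ℤ.-[1+ _ ])     _ = refl
sgn-product -1# (ℤ.-[1+ _ ])     (+ _)            _ = refl
sgn-product -1# (ℤ.-[1+ _ ])     (ℤ.-[1+ _ ])     ()

-- Signs

*-positive : ∀ {x y} → 1ℤ ≤ x → 1ℤ ≤ y → 1ℤ ≤ x * y
*-positive {+ suc m} {+ suc n} _ _ = ℤ.+≤+ (s≤s z≤n)
*-positive {+ zero} (ℤ.+≤+ ())
*-positive {+ suc m} {+ zero} _ (ℤ.+≤+ ())

unit-opposite : ∀ {x y} → Ternary x → x * y ≡ -1ℤ → x * x - x * y ≡ + 2
unit-opposite {y = y} zer eq = contradiction (trans (≡-sym (ℤₚ.*-zeroˡ y)) eq) λ ()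
unit-opposite pos eq = cong (_-_ 1ℤ) eq
unit-opposite neg eq = cong (_-_ 1ℤ) eq

-- Each term x² - xy is nonnegative, and the coordinate with opposite signs contributes 2.
ternary-gap : ∀ {n} (x y : Fin n → ℤ) → (∀ k → Ternary (x k)) → (∀ k → Ternary (y k)) →
              ∀ l → x l * y l ≡ -1ℤ → + 2 ≤ sumFin (λ k → x k * x k) - sumFin (λ k → x k * y k)
ternary-gap x y tx ty l eq = subst (+ 2 ≤_) split
  (ℤₚ.≤-trans (ℤₚ.≤-reflexive (≡-sym (unit-opposite (tx l) eq))) (term≤sum (λ k → ternary-diff (tx k) (ty k)) l))
  where
  lem : ∀ p q → p - q ≡ 1ℤ * p + -1ℤ * q
  lem = solve-∀
  split : sumFin (λ k → x k * x k - x k * y k) ≡ sumFin (λ k → x k * x k) - sumFin (λ k → x k * y k)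
  split = trans (sum-cong λ k → lem (x k * x k) (x k * y k))
         (trans (sum-linear 1ℤ -1ℤ (λ k → x k * x k) (λ k → x k * y k))
                (≡-sym (lem (sumFin (λ k → x k * x k)) (sumFin (λ k → x k * y k)))))

ternary-gap-+ : ∀ {n} (x y : Fin n → ℤ) → (∀ k → Ternary (x k)) → (∀ k → Ternary (y k)) →
                ∀ l → x l * y l ≡ 1ℤ → + 2 ≤ sumFin (λ k → x k * x k) + sumFin (λ k → x k * y k)
ternary-gap-+ x y tx ty l eq = subst (+ 2 ≤_) flipped
  (ternary-gap x (λ k → - y k) tx (λ k → ternary-neg (ty k)) l (trans (≡-sym (ℤₚ.neg-distribʳ-* (x l) (y l))) (cong -_ eq)))
  where
  lem : ∀ p q → p * - q ≡ -1ℤ * (p * q)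
  lem = solve-∀
  lem′ : ∀ p q → p - -1ℤ * q ≡ p + q
  lem′ = solve-∀
  flipped : sumFin (λ k → x k * x k) - sumFin (λ k → x k * - y k) ≡ sumFin (λ k → x k * x k) + sumFin (λ k → x k * y k)
  flipped = trans (cong (_-_ (sumFin (λ k → x k * x k))) (trans (sum-cong λ k → lem (x k) (y k)) (sum-*ˡ -1ℤ (λ k → x k * y k))))
                  (lem′ (sumFin (λ k → x k * x k)) (sumFin (λ k → x k * y k)))

-- `ε` is a potential for the signs: conjugation by its diagonal matrix turns every nonzero entry
-- into 1. For signed graphs this is Harary's balance.
Balanced : ∀ {n} → Matrix n → Set
Balanced {n} A = Σ (Fin n → ℤ) λ ε → (∀ i → Unit± (ε i)) × (∀ i j → A i j ≢ 0ℤ → A i j * (ε i * ε j) ≡ 1ℤ)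

module Signs {n} (A : Matrix n) (symA : Symmetric A) (tern : ∀ i j → Ternary (A i j))
  (c : Fin n → Bool) (off : ∀ i j → c i ≡ c j → A i j ≡ 0ℤ)
  (nb : Fin n → Fin n) (nb-adj : ∀ i → A i (nb i) ≢ 0ℤ)
  (rankOne : ∀ i j k → c i ≡ true → c j ≡ true → Square.B A symA j j * Square.B A symA i k ≡ Square.B A symA i j * Square.B A symA j k)
  (diag≥0 : ∀ i → 0ℤ ≤ Square.B A symA i i) where
  open Square A symA

  degree : ∀ i → sumFin (λ k → A i k * A i k) ≡ B i i + 1ℤ
  degree i = trans (≡-sym (A²-rows i i)) (trans (lem (A² i i)) (cong (λ x → A² i i - x + 1ℤ) (≡-sym (Id-diag i))))
    where
    lem : ∀ x → x ≡ x - 1ℤ + 1ℤ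
    lem = solve-∀

  inner : ∀ {i j} → i ≢ j → sumFin (λ k → A i k * A j k) ≡ B i j
  inner {i} {j} i≢j = trans (≡-sym (A²-rows i j)) (≡-sym (B-off i≢j))

  -- Row i has squared length B i i + 1, so the gap 2 of `ternary-gap` becomes a gap 1 between
  -- entries of `B`.
  gap- : ∀ {i j} → i ≢ j → ∀ l → A i l * A j l ≡ -1ℤ → 1ℤ ≤ B i i - B i j
  gap- {i} {j} i≢j l eq = subst (1ℤ ≤_)
      (trans (cong (_+_ -1ℤ) (cong₂ _-_ (degree i) (inner i≢j))) (lem (B i i) (B i j)))
      (ℤₚ.+-monoʳ-≤ -1ℤ (ternary-gap (A i) (A j) (tern i) (tern j) l eq))
    where
    lem : ∀ x y → -1ℤ + (x + 1ℤ - y) ≡ x - y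
    lem = solve-∀

  gap+ : ∀ {i j} → i ≢ j → ∀ l → A i l * A j l ≡ 1ℤ → 1ℤ ≤ B i i + B i j
  gap+ {i} {j} i≢j l eq = subst (1ℤ ≤_)
      (trans (cong (_+_ -1ℤ) (cong₂ _+_ (degree i) (inner i≢j))) (lem (B i i) (B i j)))
      (ℤₚ.+-monoʳ-≤ -1ℤ (ternary-gap-+ (A i) (A j) (tern i) (tern j) l eq))
    where
    lem : ∀ x y → -1ℤ + (x + 1ℤ + y) ≡ x + y
    lem = solve-∀

  -- Two common neighbours with opposite sign products would give |B i j| < B i i
  -- and |B i j| < B j j, against B i i * B j j = (B i j)².
  noOpposite : ∀ {i j} → i ≢ j → c i ≡ true → c j ≡ true →
               ∀ k l → A i k * A j k ≡ 1ℤ → A i l * A j l ≡ -1ℤ → ⊥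
  noOpposite {i} {j} i≢j ci cj k l eqk eql = contradiction (subst (+ 2 ≤_) (trans (ring α β γ) zero′) two≤) λ where (ℤ.+≤+ ())
    where
    α = B i i
    β = B j j
    γ = B i j
    j≢i = i≢j ∘ ≡-sym
    eqk′ = trans (ℤₚ.*-comm (A j k) (A i k)) eqk
    eql′ = trans (ℤₚ.*-comm (A j l) (A i l)) eql
    β-γ : 1ℤ ≤ β - γ
    β-γ = subst (λ x → 1ℤ ≤ β - x) (B-sym j i) (gap- j≢i l eql′)
    β+γ : 1ℤ ≤ β + γ
    β+γ = subst (λ x → 1ℤ ≤ β + x) (B-sym j i) (gap+ j≢i k eqk′)
    -- All four factors are at least 1, yet the sum is twice the minor that `rankOne` makes zero.
    -- This symmetric combination avoids a case distinction on the sign of `γ`.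
    two≤ : + 2 ≤ (α - γ) * (β + γ) + (α + γ) * (β - γ)
    two≤ = ℤₚ.+-mono-≤ (*-positive (gap- i≢j l eql) β+γ) (*-positive (gap+ i≢j k eqk) β-γ)
    ring : ∀ α β γ → (α - γ) * (β + γ) + (α + γ) * (β - γ) ≡ + 2 * (β * α - γ * γ)
    ring = solve-∀
    zero′ : + 2 * (β * α - γ * γ) ≡ 0ℤ
    zero′ = cong (+ 2 *_) (ℤₚ.i≡j⇒i-j≡0 (trans (rankOne i j i ci cj) (cong (γ *_) (B-sym j i))))

  -- By `noOpposite` all common neighbours contribute the same sign A i k · A j k to B i j, so after
  -- multiplication by that sign no term is negative and the term of `k` is 1.
  coherent : ∀ {i j} → i ≢ j → c i ≡ true → c j ≡ true → ∀ k → A i k ≢ 0ℤ → A j k ≢ 0ℤ →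
             1ℤ ≤ A i k * A j k * B i j
  coherent {i} {j} i≢j ci cj k ik≢0 jk≢0 = subst (1ℤ ≤_)
    (trans (sum-*ˡ ε (λ l → A i l * A j l)) (cong (ε *_) (inner i≢j)))
    (ℤₚ.≤-trans (ℤₚ.≤-reflexive (≡-sym (unit-square unitε))) (term≤sum term≥0 k))
    where
    ε = A i k * A j k
    unitε : Unit± ε
    unitε = unit-* (ternary-unit (tern i k) ik≢0) (ternary-unit (tern j k) jk≢0)
    same : ∀ {x y} → Unit± x → Ternary y → (x ≡ 1ℤ → y ≢ -1ℤ) → (x ≡ -1ℤ → y ≢ 1ℤ) → 0ℤ ≤ x * y
    same +1# zer _ _ = ℤ.+≤+ z≤n
    same +1# pos _ _ = ℤ.+≤+ z≤n
    same +1# neg p _ = contradiction refl (p refl)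
    same -1# zer _ _ = ℤ.+≤+ z≤n
    same -1# pos _ q = contradiction refl (q refl)
    same -1# neg _ _ = ℤ.+≤+ z≤n
    ternary-* : ∀ {x y} → Ternary x → Ternary y → Ternary (x * y)
    ternary-* zer _   = zer
    ternary-* pos zer = zer
    ternary-* pos pos = pos
    ternary-* pos neg = neg
    ternary-* neg zer = zer
    ternary-* neg pos = neg
    ternary-* neg neg = pos
    term≥0 : ∀ l → 0ℤ ≤ ε * (A i l * A j l)
    term≥0 l = same unitε (ternary-* (tern i l) (tern j l))
      (λ p q → noOpposite i≢j ci cj k l p q)
      (λ p q → noOpposite i≢j ci cj l k q p)

  Coherent : (Fin n → ℤ) → Set
  Coherent s = ∀ i j k → c i ≡ true → c j ≡ true → A i k ≢ 0ℤ → A j k ≢ 0ℤ → s i * s j ≡ A i k * A j k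

  -- If B o o > 0 for some `o` in the class, rank one gives B o o · B i j = B i o · B o j. The signs
  -- of row `o` thus multiply to the sign of B i j, which is the common sign of the neighbours by
  -- `coherent`. If there is no such `o`, rank one makes B i j zero throughout the class; by
  -- `coherent` distinct vertices of the class then share no neighbour, and constant signs suffice.
  signs : Σ (Fin n → ℤ) λ s → (∀ i → Unit± (s i)) × Coherent s
  signs with any? (λ i → (c i Boolₚ.≟ true) ×-dec ¬? (B i i ℤₚ.≟ 0ℤ))
  ... | yes (o , co , Boo≢0) = s , (λ i → sgn-unit (B o i)) , coh
    where
    s : Fin n → ℤ
    s i = sgn (B o i)
    1≤Boo : 1ℤ ≤ B o o
    1≤Boo = ℤₚ.i<j⇒suc[i]≤j (ℤₚ.≤∧≢⇒< (diag≥0 o) (Boo≢0 ∘ ≡-sym))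
    shuffle : ∀ e x y → x * (e * y) ≡ e * (x * y)
    shuffle = solve-∀
    coh : Coherent s
    coh i j k ci cj ik≢0 jk≢0 with i ≟ j
    ... | yes refl = trans (unit-square (sgn-unit (B o i))) (≡-sym (unit-square (ternary-unit (tern i k) ik≢0)))
    ... | no  i≢j  = sgn-product (unit-* (ternary-unit (tern i k) ik≢0) (ternary-unit (tern j k) jk≢0)) (B o i) (B o j)
      (subst (1ℤ ≤_) (trans (shuffle (A i k * A j k) (B o o) (B i j))
                            (cong (A i k * A j k *_) (trans (rankOne i o j ci co) (cong (_* B o j) (B-sym i o)))))
             (*-positive 1≤Boo (coherent i≢j ci cj k ik≢0 jk≢0)))
  ... | no  none = (λ _ → 1ℤ) , (λ _ → +1#) , coh
    where
    coh : Coherent (λ _ → 1ℤ)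
    coh i j k ci cj ik≢0 jk≢0 with i ≟ j
    ... | yes refl = ≡-sym (unit-square (ternary-unit (tern i k) ik≢0))
    ... | no  i≢j  = contradiction (subst (1ℤ ≤_) (trans (cong (A i k * A j k *_) Bij≡0) (ℤₚ.*-zeroʳ (A i k * A j k)))
                                          (coherent i≢j ci cj k ik≢0 jk≢0)) λ where (ℤ.+≤+ ())
      where
      Bii≡0 : B i i ≡ 0ℤ
      Bii≡0 with B i i ℤₚ.≟ 0ℤ
      ... | yes eq = eq
      ... | no neq = contradiction (i , ci , neq) none
      Bij≡0 : B i j ≡ 0ℤ
      Bij≡0 = square≡0 (B i j) (trans (cong (B i j *_) (B-sym i j))
        (trans (≡-sym (rankOne i j i ci cj)) (trans (cong (B j j *_) Bii≡0) (ℤₚ.*-zeroʳ (B j j)))))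

  balanced : Balanced A
  balanced = ε , unitε , edge
    where
    s = proj₁ signs
    unit-s = proj₁ (proj₂ signs)
    coh = proj₂ (proj₂ signs)
    entry : ∀ i j → A i j ≢ 0ℤ → Unit± (A i j)
    entry i j = ternary-unit (tern i j)
    nb-adj′ : ∀ i → A (nb i) i ≢ 0ℤ
    nb-adj′ i eq = nb-adj i (trans (symA i (nb i)) eq)
    -- On the opposite class a single neighbour dictates the sign; coherence makes every other
    -- neighbour agree.
    choose : Bool → Fin n → ℤ
    choose true  i = s i
    choose false i = s (nb i) * A (nb i) i
    ε : Fin n → ℤ
    ε i = choose (c i) i
    unitε : ∀ i → Unit± (ε i)
    unitε i with c i
    ... | true  = unit-s i
    ... | false = unit-* (unit-s (nb i)) (entry (nb i) i (nb-adj′ i))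
    across : ∀ i k → A i k ≢ 0ℤ → c i ≡ true → c k ≡ false → A i k * (s i * (s (nb k) * A (nb k) k)) ≡ 1ℤ
    across i k ik≢0 ci ck = trans (group (A i k) (s i) (s (nb k)) (A (nb k) k))
      (trans (cong (A i k * A (nb k) k *_) (coh i (nb k) k ci cnb ik≢0 (nb-adj′ k)))
             (unit-square (unit-* (entry i k ik≢0) (entry (nb k) k (nb-adj′ k)))))
      where
      group : ∀ x s t y → x * (s * (t * y)) ≡ x * y * (s * t)
      group = solve-∀
      cnb : c (nb k) ≡ true
      cnb with c (nb k) in eq
      ... | true  = refl
      ... | false = contradiction (off k (nb k) (trans ck (≡-sym eq))) (nb-adj k)
    edge : ∀ i j → A i j ≢ 0ℤ → A i j * (ε i * ε j) ≡ 1ℤ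
    edge i j ij≢0 with c i in ci | c j in cj
    ... | true  | true  = contradiction (off i j (trans ci (≡-sym cj))) ij≢0
    ... | false | false = contradiction (off i j (trans ci (≡-sym cj))) ij≢0
    ... | true  | false = across i j ij≢0 ci cj
    ... | false | true  = trans (cong₂ _*_ (symA i j) (ℤₚ.*-comm (s (nb i) * A (nb i) i) (s j)))
                                (across j i (λ eq → ij≢0 (trans (symA i j) eq)) cj ci)

-- Choice of the colour class

indicator-split : ∀ {n} (c : Fin n → Bool) (f : Fin n → ℤ) →
                  sumFin (λ i → indicator (c i) * f i) + sumFin (λ i → indicator (not (c i)) * f i) ≡ sumFin f
indicator-split c f = trans (≡-sym (sum-+ (λ i → indicator (c i) * f i) (λ i → indicator (not (c i)) * f i)))
                            (sum-cong λ i → term (c i) (f i))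
  where
  lem₁ : ∀ x → 1ℤ * x + 0ℤ * x ≡ x
  lem₁ = solve-∀
  lem₂ : ∀ x → 0ℤ * x + 1ℤ * x ≡ x
  lem₂ = solve-∀
  term : ∀ b x → indicator b * x + indicator (not b) * x ≡ x
  term true  = lem₁
  term false = lem₂

smaller-half : ∀ x y z → x + y ≡ z → + 2 * x ≤ z ⊎ + 2 * y ≤ z
smaller-half x y z refl with ℤₚ.≤-total x y
... | inj₁ x≤y = inj₁ (subst (_≤ x + y) (double x) (ℤₚ.+-monoʳ-≤ x x≤y))
  where
  double : ∀ x → x + x ≡ + 2 * x
  double = solve-∀
... | inj₂ y≤x = inj₂ (subst (_≤ x + y) (double y) (ℤₚ.+-monoˡ-≤ y y≤x))
  where
  double : ∀ x → x + x ≡ + 2 * x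
  double = solve-∀

module _ {n} (A : Matrix n) (symA : Symmetric A) (tern : ∀ i j → Ternary (A i j))
  (nb : Fin n → Fin n) (nb-adj : ∀ i → A i (nb i) ≢ 0ℤ) where
  open Square A symA

  diagonal-nonneg : ∀ i → 0ℤ ≤ B i i
  diagonal-nonneg i = ℤₚ.i≤j⇒0≤j-i (subst (_≤ A² i i) (≡-sym (Id-diag i)) (subst (1ℤ ≤_) (≡-sym (A²-rows i i))
    (ℤₚ.≤-trans (ℤₚ.≤-reflexive (≡-sym (unit-square (ternary-unit (tern i (nb i)) (nb-adj i)))))
                (term≤sum (λ k → square-nonneg (A i k)) (nb i)))))

  small-class⇒balanced : AllButTwoEigenvaluesPM1 A →
                         ∀ (c : Fin n → Bool) (off : ∀ i j → c i ≡ c j → A i j ≡ 0ℤ) →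
                         + 2 * sumFin (λ i → indicator (c i) * B i i) ≤ trace B → Balanced A
  small-class⇒balanced (a , b , c₀ , c₁ , c₂ , _ , factor) c off small =
    Signs.balanced A symA tern c off nb nb-adj rankOne diagonal-nonneg
    where
    open Coloured A symA c off
    open RankOne B B-sym (Quadratic.quadratic a b c₀ c₁ c₂ factor diagonal-nonneg)
                 (sum-nonneg diagonal-nonneg) c B-even small

  spectrum⇒balanced : AllButTwoEigenvaluesPM1 A →
                      ∀ (c : Fin n → Bool) → (∀ i j → c i ≡ c j → A i j ≡ 0ℤ) → Balanced A
  spectrum⇒balanced spectrum c off with smaller-half _ _ _ (indicator-split c (λ i → B i i))
  ... | inj₁ small = small-class⇒balanced spectrum c off small
  ... | inj₂ small = small-class⇒balanced spectrum (not ∘ c) (λ i j eq → off i j (Boolₚ.not-injective eq)) small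

-- Signed graphs and the switching

module _ {n} (S : SignedGraph n) where
  private
    G = graph S
    A = signedAdjMatrix S

  signedAdj-edge : ∀ {i j} → adj G i j ≡ true → A i j ≡ signToℤ (sig S i j)
  signedAdj-edge {i} {j} eq = cong (λ b → if b then signToℤ (sig S i j) else + 0) eq

  signedAdj-sym : Symmetric A
  signedAdj-sym i j = cong₂ (λ b s → if b then signToℤ s else + 0) (sym G i j) (sigSym S i j)

  signedAdj-ternary : ∀ i j → Ternary (A i j)
  signedAdj-ternary i j with adj G i j | sig S i j
  ... | false | _      = zer
  ... | true  | Sign.+ = pos
  ... | true  | Sign.- = neg

  signedAdj-nonzero : ∀ {i j} → adj G i j ≡ true → A i j ≢ 0ℤ
  signedAdj-nonzero {i} {j} eq A≡0 with sig S i j | trans (≡-sym (signedAdj-edge eq)) A≡0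
  ... | Sign.+ | ()
  ... | Sign.- | ()

  signedAdj-bipartite : ((c , _) : Bipartite G) → ∀ i j → c i ≡ c j → A i j ≡ 0ℤ
  signedAdj-bipartite (c , proper) i j ci≡cj with adj G i j in eq
  ... | true  = contradiction ci≡cj (proper i j eq)
  ... | false = refl

  balanced⇒conclusion : Connected G → Bipartite G → AllButTwoEigenvaluesPM1 A → Balanced A →
    Σ (Graph n) λ H → SwitchingIsoToUnsigned S H × Connected H × Bipartite H × AllButTwoEigenvaluesPM1 (adjMatrix H)
  balanced⇒conclusion connected bipartite (a , b , c₀ , c₁ , c₂ , n≤ , factor) (ε , unitε , edge) =
    -- Switching preserves the underlying graph, so H is G itself under the identity permutation,
    -- with X the set where `ε` is -1. Only the spectral condition has to be transported, and it
    -- keeps the same factorisation.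
    G , (X , idₚ , switched) , connected , bipartite ,
    (a , b , c₀ , c₁ , c₂ , n≤ , λ t → trans (det-cong (λ i j → cong (_-_ (if does (i ≟ j) then t else + 0)) (unsigned i j)))
                                    (trans (charPolyAt-conjugate A ε (unit-square ∘ unitε) t) (factor t)))
    where
    negative : ∀ {x} → Unit± x → Bool
    negative +1# = false
    negative -1# = true
    X : Fin n → Bool
    X i = negative (unitε i)
    unit-cancel : ∀ {x y} s (p : Unit± x) (q : Unit± y) → signToℤ s * (x * y) ≡ 1ℤ →
                  signToℤ (s *ˢ (if negative p xor negative q then Sign.- else Sign.+)) ≡ 1ℤ
    unit-cancel Sign.+ +1# +1# _ = refl
    unit-cancel Sign.+ -1# -1# _ = refl
    unit-cancel Sign.- +1# -1# _ = refl
    unit-cancel Sign.- -1# +1# _ = refl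
    edge′ : ∀ i j → adj G i j ≡ true → signToℤ (sig S i j) * (ε i * ε j) ≡ 1ℤ
    edge′ i j eq = trans (cong (_* (ε i * ε j)) (≡-sym (signedAdj-edge eq))) (edge i j (signedAdj-nonzero eq))
    switched : ∀ i j → signedAdjMatrix (switch S X) i j ≡ adjMatrix G i j
    switched i j with adj G i j in eq
    ... | true  = unit-cancel (sig S i j) (unitε i) (unitε j) (edge′ i j eq)
    ... | false = refl
    unsigned : ∀ i j → adjMatrix G i j ≡ ε i * ε j * A i j
    unsigned i j with adj G i j in eq
    ... | true  = ≡-sym (trans (ℤₚ.*-comm (ε i * ε j) (signToℤ (sig S i j))) (edge′ i j eq))
    ... | false = ≡-sym (ℤₚ.*-zeroʳ (ε i * ε j))

neighbour : ∀ {n} {G : Graph n} {i j} → Walk G i j → i ≢ j → Σ (Fin n) λ k → adj G i k ≡ true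
neighbour here         i≢j = contradiction refl i≢j
neighbour (step {j = k} edge _) _ = k , edge

other : ∀ {n} (i : Fin (suc (suc n))) → Σ (Fin (suc (suc n))) (i ≢_)
other zero    = suc zero , λ ()
other (suc i) = zero , λ ()

theorem4p1 : ∀ {n : ℕ} (S : SignedGraph n) →
    Connected (graph S) → Bipartite (graph S) →
    AllButTwoEigenvaluesPM1 (signedAdjMatrix S) →
    Σ (Graph n) λ H →
    SwitchingIsoToUnsigned S H × Connected H × Bipartite H ×
    AllButTwoEigenvaluesPM1 (adjMatrix H)
-- On fewer than two vertices no vertex has a neighbour to choose, but there is no edge to balance
-- either.
theorem4p1 {zero} S connected bipartite spectrum =
  balanced⇒conclusion S connected bipartite spectrum ((λ ()) , (λ ()) , λ ())
theorem4p1 {suc zero} S connected bipartite spectrum =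
  balanced⇒conclusion S connected bipartite spectrum ((λ _ → 1ℤ) , (λ _ → +1#) , λ where
    zero zero A≢0 → contradiction (cong (λ b → if b then signToℤ (sig S zero zero) else + 0) (irr (graph S) zero)) A≢0)
theorem4p1 {suc (suc n)} S connected bipartite spectrum =
  balanced⇒conclusion S connected bipartite spectrum
    (spectrum⇒balanced (signedAdjMatrix S) (signedAdj-sym S) (signedAdj-ternary S)
      (λ i → proj₁ (nb i)) (λ i → signedAdj-nonzero S (proj₂ (nb i)))
      spectrum (proj₁ bipartite) (signedAdj-bipartite S bipartite))
  where
  nb : ∀ i → Σ (Fin (suc (suc n))) λ k → adj (graph S) i k ≡ true
  nb i = neighbour (connected i (proj₁ (other i))) (proj₂ (other i))
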